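{- Let $\mathcal{P}\in\mathcal{P}_{n,m}$ be an adversarial strategy. Let $\boldsymbol{\ell}=\boldsymbol{\ell}(\mathrm{BL},\mathcal{P})$, let $\boldsymbol{\ell}^\circ\in\mathbb{Z}_{\ge0}^m$ be its conjugate load vector, and set $\boldsymbol{\ell}^\circ(0)=n$. Let $\widehat{\mathcal{P}}$ be the adversarial strategy that, regardless of the history of play, presents the following fixed sequence of polymatroids: for $j=1,2,\dots,m$ in order, $\boldsymbol{\ell}^\circ(j)$ consecutive copies of the discrete polymatroid with rank function $A\mapsto \mathbf{1}\{A\cap[\boldsymbol{\ell}^\circ(j-1)]\ne\emptyset\}$. Then $\widehat{\mathcal{P}}\in\mathcal{P}_{n,m}$, $\widehat{\mathcal{P}}$ is a nested strategy, and $$\boldsymbol{\ell}(\mathrm{BL},\mathcal{P})\sim\boldsymbol{\ell}(\mathrm{BL},\widehat{\mathcal{P}})\qquad\text{and}\qquad \mathrm{OPT}(\mathrm{BL},\mathcal{P})\succeq\mathrm{OPT}(\mathrm{BL},\widehat{\mathcal{P}}).$$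
   Context: **Notation.** $[n]=\{1,\dots,n\}$; for a vector $\mathbf{x}$ indexed by $[n]$ and $A\subseteq[n]$, $\mathbf{x}(A)=\sum_{i\in A}\mathbf{x}(i)$. **Discrete polymatroids.** A rank function is $r:2^{[n]}\to\mathbb{Z}_{\ge 0}$ that is normalized ($r(\emptyset)=0$), monotone ($r(A)\le r(B)$ for $A\subseteq B$) and submodular ($r(A)+r(B)\ge r(A\cap B)+r(A\cup B)$). It defines the discrete polymatroid $P=\{\mathbf{x}\in\mathbb{Z}_{\ge0}^n : \mathbf{x}(A)\le r(A)\ \forall A\subseteq[n]\}$, with $\mathrm{Rank}(P)=r([n])$ and $\mathrm{Bases}(P)=\{\mathbf{x}\in P:\mathbf{x}([n])=r([n])\}$. **Game.** On round $t=1,2,\dots$ the adversary presents a discrete polymatroid $P_t$ on $[n]$; the algorithm designer then irrevocably selects a basis $\mathbf{x}_t\in\mathrm{Bases}(P_t)$. The game ends after a finite number $h$ of rounds, when $\sum_{t=1}^h \mathrm{Rank}(P_t)=m$ exactly. An adversarial strategy $\mathcal{P}$ deterministically maps the history of play (all previous polymatroids and selected bases) to the next polymatroid; $\mathcal{P}_{n,m}$ is the set of adversarial strategies for $n$ agents and $m$ resources (against every designer strategy, the total rank presented is exactly $m$). An allocation strategy $\mathcal{A}$ maps, possibly at random, a history of play and the currently presented polymatroid to a basis of that polymatroid. The profile $(\mathcal{A},\mathcal{P})$ induces a (possibly random) sequence of polymatroids $(P_t)_{t\in[h]}$ and bases $(\mathbf{x}_t)_{t\in[h]}$; set $\boldsymbol{\ell}(\mathcal{A},\mathcal{P})=\sum_{t\in[h]}\mathbf{x}_t$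 (the load vector) and $H(\mathcal{A},\mathcal{P})=\{\sum_{t\in[h]}\mathbf{z}_t:\mathbf{z}_t\in\mathrm{Bases}(P_t)\}$. **Majorization.** For $\mathbf{x},\mathbf{y}\in\mathbb{Z}_{\ge0}^n$ with $\mathbf{x}([n])=\mathbf{y}([n])$, write $\mathbf{x}\succeq\mathbf{y}$ (equivalently $\mathbf{y}\preceq\mathbf{x}$) when $\mathbf{x}^{\uparrow}([k])\le\mathbf{y}^{\uparrow}([k])$ for all $k\in[n]$, where $\mathbf{x}^\uparrow(i)$ is the $i$-th smallest entry of $\mathbf{x}$. Write $\mathbf{x}\sim\mathbf{y}$ when $\mathbf{x}\preceq\mathbf{y}$ and $\mathbf{x}\succeq\mathbf{y}$, i.e. $\mathbf{x}$ and $\mathbf{y}$ are equal up to permutation of coordinates. **Hindsight optimum.** $\mathrm{OPT}(\mathcal{A},\mathcal{P})$ denotes a majorization-minimal element of $H(\mathcal{A},\mathcal{P})$, i.e. $\boldsymbol{\ell}^*\in H(\mathcal{A},\mathcal{P})$ with $\boldsymbol{\ell}^*\preceq\boldsymbol{\ell}$ for all $\boldsymbol{\ell}\in H(\mathcal{A},\mathcal{P})$ (it always exists and is unique up to permutation). **Brick-Laying.** $\mathrm{BL}$ is the deterministic strategy which, on round $t$ with current load $\boldsymbol{\ell}_{t-1}=\sum_{s<t}\mathbf{x}_s$, selects an $\mathbf{x}_t\in\mathrm{Bases}(P_t)$ with $\boldsymbol{\ell}_{t-1}+\mathbf{x}_t\preceq\boldsymbol{\ell}_{t-1}+\mathbf{x}$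 for all $\mathbf{x}\in\mathrm{Bases}(P_t)$ (such a basis always exists), ties broken by some deterministic rule. It is assumed that when presented with a rank-$1$ polymatroid, $\mathrm{BL}$ breaks ties in favor of agents with lower index: it selects the standard basis vector $\chi_i$ where $i$ is the smallest index minimizing $\boldsymbol{\ell}_{t-1}(i)$ over $\{i:\chi_i\in\mathrm{Bases}(P_t)\}$. **Conjugate.** For $\boldsymbol{\ell}\in\mathbb{Z}_{\ge0}^n$ with $\boldsymbol{\ell}([n])=m$, the conjugate $\boldsymbol{\ell}^\circ\in\mathbb{Z}_{\ge0}^m$ is $\boldsymbol{\ell}^\circ(j)=|\{i\in[n]:\boldsymbol{\ell}(i)\ge j\}|$, $j\in[m]$. **Nested strategy.** $\mathcal{P}\in\mathcal{P}_{n,m}$ is nested if, for every allocation strategy $\mathcal{A}$, with probability $1$ the profile $(\mathcal{A},\mathcal{P})$ induces a polymatroid sequence $P_1,\dots,P_m$ whose rank functions have the form $r_t(A)=\mathbf{1}\{A\cap N_t\neq\emptyset\}$ with $N_1\supseteq\dots\supseteq N_m$. -}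

module Defs where

open import Algebra.Apartness.Bundles using (HeytingField)
open import Data.Bool.Base using (Bool; if_then_else_; T)
open import Data.Fin.Base as Fin using (Fin; toℕ; inject₁)
open import Data.Fin.Subset
  using (Subset; ⊥; ⊤; _∩_; _∪_; _⊆_; _⊇_; Nonempty)
open import Data.Fin.Subset.Properties
  using (nonempty?; ∉⊥; x∈p∩q⁺; x∈p∩q⁻; x∈p∪q⁻)
open import Data.List.Base as List using (List; []; _∷_; length)
open import Data.List.Relation.Binary.Pointwise.Base using (Pointwise)
open import Data.List.Relation.Unary.All as All using (All; []; _∷_)
open import Data.List.Relation.Unary.Linked using (Linked)
import Data.List.Sort
open import Data.Maybe.Base using (fromMaybe)
open import Data.Nat.Base using (ℕ; zero; suc; _+_; _≤_; z≤n; s≤s)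
open import Data.Nat.ListAction using (sum)
open import Data.Nat.Properties
  using (≤-decTotalOrder; _≤?_; _<?_; _≟_; ≤-refl; +-mono-≤)
open import Data.Product.Base
  using (Σ; Σ-syntax; ∃-syntax; _×_; _,_; proj₁; proj₂)
open import Data.Sum.Base using (_⊎_; [_,_])
open import Data.Vec.Base as Vec using (Vec; lookup; toList; tabulate; _[_]≔_)
open import Function.Base using (_∘_)
open import Level using (_⊔_) renaming (suc to lsuc)
open import Relation.Binary.Core using (Rel)
open import Relation.Binary.PropositionalEquality using (_≡_; refl)
open import Relation.Binary.Structures using (IsPartialOrder)
open import Relation.Nullary using (¬_; yes; no; does)
open import Relation.Nullary.Negation using (contradiction)

private
  variable
    n : ℕ

infixl 6 _⊕_

_⊕_ : Vec ℕ n → Vec ℕ n → Vec ℕ n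
_⊕_ = Vec.zipWith _+_

𝟎 : Vec ℕ n
𝟎 = Vec.replicate _ 0

χ : Fin n → Vec ℕ n
χ i = 𝟎 [ i ]≔ 1

∑ : List (Vec ℕ n) → Vec ℕ n
∑ = List.foldr _⊕_ 𝟎

-- x ⟨ A ⟩ is 𝐱(A), the sum of the entries of x with index in A.
_⟨_⟩ : Vec ℕ n → Subset n → ℕ
x ⟨ A ⟩ = Vec.sum (Vec.zipWith (λ inside? a → if inside? then a else 0) A x)

open Data.List.Sort ≤-decTotalOrder using (sort)

-- The sum of the k smallest entries, 𝐱↑([k]).
smallest : ℕ → Vec ℕ n → ℕ
smallest k x = sum (List.take k (sort (toList x)))

infix 4 _⪰_ _⪯_ _∼_

-- The index k : Fin n stands for the element k + 1 of {1, …, n}.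
_⪰_ : Vec ℕ n → Vec ℕ n → Set
_⪰_ {n} x y =
  Vec.sum x ≡ Vec.sum y ×
  (∀ (k : Fin n) → smallest (suc (toℕ k)) x ≤ smallest (suc (toℕ k)) y)

_⪯_ : Vec ℕ n → Vec ℕ n → Set
x ⪯ y = y ⪰ x

_∼_ : Vec ℕ n → Vec ℕ n → Set
x ∼ y = x ⪯ y × x ⪰ y

record Polymatroid (n : ℕ) : Set where
  field
    rank       : Subset n → ℕ
    normalized : rank ⊥ ≡ 0
    monotone   : ∀ {A B} → A ⊆ B → rank A ≤ rank B
    submodular : ∀ A B → rank (A ∩ B) + rank (A ∪ B) ≤ rank A + rank B

open Polymatroid public using (rank)

Rank : Polymatroid n → ℕ
Rank P = rank P ⊤

_∈ₚ_ : Vec ℕ n → Polymatroid n → Set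
x ∈ₚ P = ∀ A → x ⟨ A ⟩ ≤ rank P A

IsBasis : Polymatroid n → Vec ℕ n → Set
IsBasis P x = x ∈ₚ P × x ⟨ ⊤ ⟩ ≡ rank P ⊤

record Basis (P : Polymatroid n) : Set where
  field
    vector  : Vec ℕ n
    isBasis : IsBasis P vector

open Basis public using (vector)

-- 𝟏{A ∩ N ≠ ∅}
meets : Subset n → Subset n → ℕ
meets N A = if does (nonempty? (A ∩ N)) then 1 else 0

private
  meets≤1 : ∀ (N A : Subset n) → meets N A ≤ 1
  meets≤1 N A with nonempty? (A ∩ N)
  ... | yes _ = ≤-refl
  ... | no _  = z≤n

  meets-empty : ∀ (N A : Subset n) → ¬ Nonempty (A ∩ N) → meets N A ≡ 0
  meets-empty N A ¬p with nonempty? (A ∩ N)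
  ... | yes p = contradiction p ¬p
  ... | no _  = refl

  meets-⊥ : ∀ (N : Subset n) → meets N ⊥ ≡ 0
  meets-⊥ N = meets-empty N ⊥ λ (_ , x∈) → ∉⊥ (proj₁ (x∈p∩q⁻ ⊥ N x∈))

  meets-mono : ∀ (N : Subset n) {A B} → A ⊆ B → meets N A ≤ meets N B
  meets-mono N {A} {B} A⊆B with nonempty? (A ∩ N) | nonempty? (B ∩ N)
  ... | no _          | _      = z≤n
  ... | yes _         | yes _  = ≤-refl
  ... | yes (_ , x∈)  | no ¬q  =
    let x∈A , x∈N = x∈p∩q⁻ A N x∈ in contradiction (_ , x∈p∩q⁺ (A⊆B x∈A , x∈N)) ¬q

  meets-submodular : ∀ (N A B : Subset n) →
    meets N (A ∩ B) + meets N (A ∪ B) ≤ meets N A + meets N B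
  meets-submodular N A B with nonempty? (A ∩ N) | nonempty? (B ∩ N)
  ... | yes _ | yes _ = +-mono-≤ (meets≤1 N (A ∩ B)) (meets≤1 N (A ∪ B))
  ... | no ¬p | q
    rewrite meets-empty N (A ∩ B)
      (λ (_ , x∈) → let x∈AB , x∈N = x∈p∩q⁻ (A ∩ B) N x∈ in
        ¬p (_ , x∈p∩q⁺ (proj₁ (x∈p∩q⁻ A B x∈AB) , x∈N)))
    with q
  ...   | yes _ = meets≤1 N (A ∪ B)
  ...   | no ¬q
    rewrite meets-empty N (A ∪ B)
      (λ (_ , x∈) → let x∈AB , x∈N = x∈p∩q⁻ (A ∪ B) N x∈ in
        [ (λ x∈A → ¬p (_ , x∈p∩q⁺ (x∈A , x∈N)))
        , (λ x∈B → ¬q (_ , x∈p∩q⁺ (x∈B , x∈N))) ]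
        (x∈p∪q⁻ A B x∈AB))
    = z≤n
  meets-submodular N A B | yes _ | no ¬q
    rewrite meets-empty N (A ∩ B)
      (λ (_ , x∈) → let x∈AB , x∈N = x∈p∩q⁻ (A ∩ B) N x∈ in
        ¬q (_ , x∈p∩q⁺ (proj₂ (x∈p∩q⁻ A B x∈AB) , x∈N)))
    = meets≤1 N (A ∪ B)

meetsPolymatroid : Subset n → Polymatroid n
meetsPolymatroid N = record
  { rank       = meets N
  ; normalized = meets-⊥ N
  ; monotone   = meets-mono N
  ; submodular = meets-submodular N
  }

-- Most recent round first.
History : ℕ → Set
History n = List (Σ (Polymatroid n) Basis)

-- Chronological.
presented : History n → List (Polymatroid n)
presented H = List.reverse (List.map proj₁ H)

totalRank : History n → ℕ
totalRank H = sum (List.map (Rank ∘ proj₁) H)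

load : History n → Vec ℕ n
load H = ∑ (List.map (vector ∘ proj₂) H)

InHindsight : History n → Vec ℕ n → Set
InHindsight H x =
  Σ[ zs ∈ All Basis (presented H) ] x ≡ ∑ (All.reduce vector zs)

IsOPT : History n → Vec ℕ n → Set
IsOPT H x = InHindsight H x × (∀ y → InHindsight H y → x ⪯ y)

-- The values on histories that are already complete, or that cannot be
-- reached, play no role.
AdversarialStrategy : ℕ → Set
AdversarialStrategy n = History n → Polymatroid n

DeterministicAllocation : ℕ → Set
DeterministicAllocation n = (H : History n) (P : Polymatroid n) → Basis P

-- At most k further rounds from H; play stops once the total rank is m.
play : ℕ → AdversarialStrategy n → DeterministicAllocation n →
       ℕ → History n → History n
play m 𝒫 𝒜 zero    H = H
play m 𝒫 𝒜 (suc k) H =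
  if does (totalRank H ≟ m) then H
  else play m 𝒫 𝒜 k ((𝒫 H , 𝒜 H (𝒫 H)) ∷ H)

record IsBrickLaying (𝒜 : DeterministicAllocation n) : Set where
  field
    minimal : ∀ H P (y : Basis P) →
      load H ⊕ vector (𝒜 H P) ⪯ load H ⊕ vector y
    tieBreak : ∀ H P → Rank P ≡ 1 →
      ∃[ i ] vector (𝒜 H P) ≡ χ i
           × (∀ j → IsBasis P (χ j) → lookup (load H) i ≤ lookup (load H) j)
           × (∀ j → IsBasis P (χ j) → lookup (load H) j ≡ lookup (load H) i →
              i Fin.≤ j)

NestedSequence : List (Polymatroid n) → Set
NestedSequence {n} Ps = ∃[ Ns ]
  Pointwise (λ P N → ∀ A → rank P A ≡ meets N A) Ps Ns × Linked _⊇_ Ns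

-- The scalars in which probabilities are valued.  The library has no real
-- numbers; they, like the rationals, are an instance of this structure.
-- An order on a Heyting field, rather than a decidable total order, so that
-- constructive reals qualify; classically this is an ordered field.
record OrderedField c ℓ₁ ℓ₂ ℓ₃ : Set (lsuc (c ⊔ ℓ₁ ⊔ ℓ₂ ⊔ ℓ₃)) where
  field
    heytingField : HeytingField c ℓ₁ ℓ₂
  open HeytingField heytingField public
    using (Carrier; _≈_; _#_; 0#; 1#; +-identityʳ)
    renaming (_+_ to _+ᶠ_; _*_ to _*ᶠ_)
  field
    _≤ᶠ_           : Rel Carrier ℓ₃
    isPartialOrder : IsPartialOrder _≈_ _≤ᶠ_
    #-comparable   : ∀ {x y} → x # y → x ≤ᶠ y ⊎ y ≤ᶠ x
    +-monoˡ        : ∀ z {x y} → x ≤ᶠ y → (x +ᶠ z) ≤ᶠ (y +ᶠ z)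
    *-nonneg       : ∀ {x y} → 0# ≤ᶠ x → 0# ≤ᶠ y → 0# ≤ᶠ (x *ᶠ y)
    0≤1            : 0# ≤ᶠ 1#

module _ {c ℓ₁ ℓ₂ ℓ₃} (𝕂 : OrderedField c ℓ₁ ℓ₂ ℓ₃) where

  open OrderedField 𝕂

  sumᶠ : List Carrier → Carrier
  sumᶠ = List.foldr _+ᶠ_ 0#

  -- Finitely supported; this is no restriction on a finite set such as the
  -- set of bases of a discrete polymatroid.
  record Distribution (A : Set) : Set (c ⊔ ℓ₁ ⊔ ℓ₃) where
    field
      outcomes    : List (Carrier × A)
      nonnegative : All (λ (w , _) → 0# ≤ᶠ w) outcomes
      total       : sumᶠ (List.map proj₁ outcomes) ≈ 1#

  expectation : {A : Set} → Distribution A → (A → Carrier) → Carrier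
  expectation μ f =
    sumᶠ (List.map (λ (w , a) → w *ᶠ f a) (Distribution.outcomes μ))

  AllocationStrategy : ℕ → Set (c ⊔ ℓ₁ ⊔ ℓ₃)
  AllocationStrategy n = (H : History n) (P : Polymatroid n) → Distribution (Basis P)

  deterministic : DeterministicAllocation n → AllocationStrategy n
  deterministic 𝒜 H P = record
    { outcomes    = (1# , 𝒜 H P) ∷ []
    ; nonnegative = 0≤1 ∷ []
    ; total       = +-identityʳ 1#
    }

  -- The probability that the history lies in S after at most k further
  -- rounds from H.
  probability : ℕ → AdversarialStrategy n → AllocationStrategy n →
                ℕ → (History n → Bool) → History n → Carrier
  probability m 𝒫 𝒜 zero    S H = if S H then 1# else 0#
  probability m 𝒫 𝒜 (suc k) S H =
    if does (totalRank H ≟ m) then (if S H then 1# else 0#)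
    else expectation (𝒜 H (𝒫 H))
           (λ x → probability m 𝒫 𝒜 k S ((𝒫 H , x) ∷ H))

  -- E contains an event of probability 1; the Boolean S makes the event
  -- measurable without requiring E itself to be decidable.
  AlmostSurely : ℕ → AdversarialStrategy n → AllocationStrategy n →
                 ℕ → (History n → Set) → Set ℓ₁
  AlmostSurely m 𝒫 𝒜 k E = ∃[ S ]
    (∀ H → T (S H) → E H) × probability m 𝒫 𝒜 k S [] ≈ 1#

  -- Membership in 𝒫ₙ,ₘ.
  IsAdversarial : ℕ → AdversarialStrategy n → Set (c ⊔ ℓ₁ ⊔ ℓ₃)
  IsAdversarial m 𝒫 = ∀ 𝒜 → ∃[ h ]
    AlmostSurely m 𝒫 𝒜 h (λ H → totalRank H ≡ m)

  IsNested : ℕ → AdversarialStrategy n → Set (c ⊔ ℓ₁ ⊔ ℓ₃)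
  IsNested m 𝒫 = ∀ 𝒜 → ∃[ h ]
    AlmostSurely m 𝒫 𝒜 h
      (λ H → totalRank H ≡ m × length H ≡ m × NestedSequence (presented H))

  module _ {m : ℕ} {𝒫 : AdversarialStrategy n} where

    -- The complete history induced by a deterministic profile.
    outcome : IsAdversarial m 𝒫 → DeterministicAllocation n → History n
    outcome 𝒫∈ 𝒜 = play m 𝒫 𝒜 (proj₁ (𝒫∈ (deterministic 𝒜))) []

    finalLoad : IsAdversarial m 𝒫 → DeterministicAllocation n → Vec ℕ n
    finalLoad 𝒫∈ 𝒜 = load (outcome 𝒫∈ 𝒜)

-- Position j : Fin m holds ℓ°(j + 1).
conjugate : ∀ m → Vec ℕ n → Vec ℕ m
conjugate m ℓ = tabulate (λ j → Vec.count (suc (toℕ j) ≤?_) ℓ)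

-- The set [k] of the k lowest-indexed agents.
initial : ℕ → Subset n
initial k = tabulate (λ i → does (toℕ i <? k))

nestedSequence : ∀ m → Vec ℕ n → List (Polymatroid n)
nestedSequence {n} m ℓ = List.concatMap block (List.allFin m)
  where
  ℓ° : Vec ℕ m
  ℓ° = conjugate m ℓ

  block : Fin m → List (Polymatroid n)
  block j = List.replicate (lookup ℓ° j)
    (meetsPolymatroid (initial (lookup (n Vec.∷ ℓ°) (inject₁ j))))

-- After the end of the sequence the strategy presents a polymatroid of rank
-- zero; no play of total rank m gets that far.
nestedStrategy : ∀ m → Vec ℕ n → AdversarialStrategy n
nestedStrategy m ℓ H =
  fromMaybe (meetsPolymatroid ⊥)
    (List.head (List.drop (length H) (nestedSequence m ℓ)))

-- x ⪰ y holds iff the sums agree and Σᵢ min(xᵢ, c) ≤ Σᵢ min(yᵢ, c) for every c.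
-- Let ℓ be the load of Brick-Laying against 𝒫, fix q and put A = {i : ℓᵢ < q}.
-- An exchange argument shows that each round raises Σᵢ min(·, q) by at least
-- r_t(A), so Σ_t r_t(A) ≤ Σ_{j ≤ q} ℓ°(j).  As |Aᶜ| = ℓ°(q), every hindsight load z
-- of 𝒫 satisfies Σᵢ min(zᵢ, c) ≤ c ℓ°(q) + Σ_{j ≤ q} ℓ°(j), for all q.  Against the
-- nested sequence this bound is attained for some q: assign the rounds from last
-- to first, each to an agent of load below c when there is one; whenever there
-- is none, the presented set [ℓ°(q)] already carries c units per agent.
-- Brick-Laying itself fills the levels of the nested sequence one block at a time,
-- leaving a load with conjugate ℓ°.

module Submission where

open import Defs
open import Algebra.Apartness.Bundles using (HeytingField)
import Algebra.Properties.CommutativeSemigroup as CommutativeSemigroup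
open import Data.Bool.Base using (true; false; T; if_then_else_)
open import Data.Bool.Properties using (T-≡)
open import Data.Fin.Base as Fin using (Fin; toℕ; fromℕ<; inject₁)
open import Data.Fin.Properties using (toℕ-fromℕ<; toℕ-inject₁; toℕ-injective; any?)
open import Data.Fin.Subset
  using (Subset; ⊥; ⊤; ⁅_⁆; _∩_; _∪_; _∈_; _∉_; _⊆_; _⊇_; Nonempty)
open import Data.Fin.Subset.Properties
  using (_∈?_; anySubset?; nonempty?; ∈⊤; ⊆⊤; ∉⊥; x∈p∩q⁺; x∈p∩q⁻; x∈p∪q⁺; x∈p∪q⁻;
         x∈⁅x⁆; x∈⁅y⁆⇒x≡y)
open import Data.List.Base as List
  using (List; []; _∷_; length; take; drop; head; replicate; _++_)
open import Data.List.Membership.Propositional.Properties using (∈-allFin)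
open import Data.List.Properties
  using (map-tabulate; map-∘; length-++; length-replicate; length-reverse; length-map;
         unfold-reverse; ++-assoc; ++-identityʳ)
open import Data.List.Relation.Binary.Permutation.Propositional.Properties
  using (map⁺; ↭-length; ↭-reverse)
open import Data.List.Relation.Binary.Pointwise as Pointwise using (Pointwise; []; _∷_)
open import Data.List.Relation.Unary.All as All using (All; []; _∷_)
open import Data.List.Relation.Unary.All.Properties using (++⁺; ++⁻ˡ; replicate⁺)
open import Data.List.Relation.Unary.Linked as Linked using (Linked; []; [-]; _∷_)
open import Data.List.Relation.Unary.Linked.Properties using (Linked⇒All)
open import Data.List.Sort using (sort; sort-↭; sort-↗)
open import Data.Maybe.Base using (fromMaybe)
open import Data.Nat
open import Data.Nat.ListAction using (sum)
open import Data.Nat.ListAction.Properties using (sum-↭)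
open import Data.Nat.Properties
open import Data.Nat.Tactic.RingSolver using (solve-∀)
open import Data.Product using (Σ-syntax; ∃-syntax; _×_; _,_; proj₁; proj₂)
open import Data.Sum.Base using (_⊎_; inj₁; inj₂; [_,_])
open import Data.Vec.Base as Vec using (Vec; []; _∷_; lookup; toList; here; there)
open import Data.Vec.Properties
  using (length-toList; toList-map; lookup-map; lookup-zipWith; lookup-replicate;
         lookup∘update; lookup∘update′; lookup∘tabulate; []=⇒lookup; lookup⇒[]=; count≤n)
open import Function.Base using (_∘_; id)
open import Function.Bundles using (Equivalence)
open import Relation.Binary.PropositionalEquality hiding ([_])
open import Relation.Nullary
open import Relation.Nullary.Decidable
  using (dec-true; dec-false; isYes; toWitness; fromWitness; decidable-stable; map′; _×-dec_; ¬?)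

open CommutativeSemigroup +-commutativeSemigroup
  using () renaming (interchange to +-interchange; x∙yz≈y∙xz to x+[y+z]≡y+[x+z])

private
  variable
    n : ℕ

-- Majorization through truncated sums

-- The number of units of load at level at most c, that is
-- Σ_{j ≤ c} x°(j).
capped : ℕ → Vec ℕ n → ℕ
capped c x = Vec.sum (Vec.map (_⊓ c) x)

cappedList : ℕ → List ℕ → ℕ
cappedList c xs = sum (List.map (_⊓ c) xs)

cappedList≤length* : ∀ c xs → cappedList c xs ≤ length xs * c
cappedList≤length* c []       = z≤n
cappedList≤length* c (x ∷ xs) = +-mono-≤ (m⊓n≤n x c) (cappedList≤length* c xs)

length*≤cappedList : ∀ {c xs} → All (c ≤_) xs → length xs * c ≤ cappedList c xs
length*≤cappedList []         = z≤n
length*≤cappedList (c≤x ∷ c≤xs) =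
  +-mono-≤ (≤-reflexive (sym (m≥n⇒m⊓n≡n c≤x))) (length*≤cappedList c≤xs)

-- The first `k` entries are bounded by themselves and each of the others by `c`.
cappedList≤take : ∀ c k xs →
  cappedList c xs ≤ sum (take k xs) + (length xs ∸ k) * c
cappedList≤take c zero    xs       = cappedList≤length* c xs
cappedList≤take c (suc k) []       = z≤n
cappedList≤take c (suc k) (x ∷ xs) = begin
  x ⊓ c + cappedList c xs                            ≤⟨ +-mono-≤ (m⊓n≤m x c) (cappedList≤take c k xs) ⟩
  x + (sum (take k xs) + (length xs ∸ k) * c)        ≡⟨ +-assoc x _ _ ⟨
  x + sum (take k xs) + (length xs ∸ k) * c          ∎
  where open ≤-Reasoning

above-head : ∀ {x xs} → Linked _≤_ (x ∷ xs) → All (x ≤_) xs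
above-head [-]          = []
above-head (x≤y ∷ sorted) = Linked⇒All ≤-trans x≤y sorted

-- The witness is the last entry taken, or `lo` if none is: in a sorted list it dominates what was
-- taken and is at most what remains. Passing the head on as the next `lo` ensures that the cap does
-- not cut it.
take≤cappedList : ∀ k lo xs → All (lo ≤_) xs → Linked _≤_ xs →
  ∃[ c ] lo ≤ c × sum (take k xs) + (length xs ∸ k) * c ≤ cappedList c xs
take≤cappedList zero    lo xs       lo≤xs        _      = lo , ≤-refl , length*≤cappedList lo≤xs
take≤cappedList (suc k) lo []       _            _      = lo , ≤-refl , z≤n
take≤cappedList (suc k) lo (x ∷ xs) (lo≤x ∷ _) sorted
  with c , x≤c , bound ← take≤cappedList k x xs (above-head sorted) (Linked.tail sorted)
  = c , ≤-trans lo≤x x≤c , (begin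
  x + sum (take k xs) + (length xs ∸ k) * c    ≡⟨ +-assoc x _ _ ⟩
  x + (sum (take k xs) + (length xs ∸ k) * c)  ≤⟨ +-mono-≤ (≤-reflexive (sym (m≤n⇒m⊓n≡m x≤c))) bound ⟩
  x ⊓ c + cappedList c xs                      ∎)
  where open ≤-Reasoning

-- `k` counts the entries up to `c`; in a sorted list these come first, and all later ones are cut
-- down to `c`.
cappedList-attained : ∀ c xs → Linked _≤_ xs →
  ∃[ k ] k ≤ length xs × sum (take k xs) + (length xs ∸ k) * c ≤ cappedList c xs
cappedList-attained c []       _      = 0 , z≤n , z≤n
cappedList-attained c (x ∷ xs) sorted with x ≤? c
... | yes x≤c with k , k≤ , bound ← cappedList-attained c xs (Linked.tail sorted) =
  suc k , s≤s k≤ , (begin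
  x + sum (take k xs) + (length xs ∸ k) * c    ≡⟨ +-assoc x _ _ ⟩
  x + (sum (take k xs) + (length xs ∸ k) * c)  ≤⟨ +-mono-≤ (≤-reflexive (sym (m≤n⇒m⊓n≡m x≤c))) bound ⟩
  x ⊓ c + cappedList c xs                      ∎)
  where open ≤-Reasoning
... | no x≰c = 0 , z≤n ,
  length*≤cappedList (c≤x ∷ All.map (≤-trans c≤x) (above-head sorted))
  where c≤x = ≰⇒≥ x≰c

sorted : Vec ℕ n → List ℕ
sorted x = sort ≤-decTotalOrder (toList x)

sorted-↗ : (x : Vec ℕ n) → Linked _≤_ (sorted x)
sorted-↗ x = sort-↗ ≤-decTotalOrder (toList x)

length-sorted : (x : Vec ℕ n) → length (sorted x) ≡ n
length-sorted x =
  trans (↭-length (sort-↭ ≤-decTotalOrder (toList x))) (length-toList x)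

sum-toList : (x : Vec ℕ n) → sum (toList x) ≡ Vec.sum x
sum-toList []       = refl
sum-toList (a ∷ x) = cong (a +_) (sum-toList x)

capped-sorted : ∀ c (x : Vec ℕ n) → cappedList c (sorted x) ≡ capped c x
capped-sorted c x = begin
  sum (List.map (_⊓ c) (sorted x))     ≡⟨ sum-↭ (map⁺ (_⊓ c) (sort-↭ ≤-decTotalOrder (toList x))) ⟩
  sum (List.map (_⊓ c) (toList x))     ≡⟨ cong sum (toList-map (_⊓ c) x) ⟨
  sum (toList (Vec.map (_⊓ c) x))      ≡⟨ sum-toList (Vec.map (_⊓ c) x) ⟩
  capped c x                           ∎
  where open ≡-Reasoning

-- capped and smallest are Legendre dual to each other:
-- capped c x is the minimum over k of smallest k x + (n ∸ k) * c.
capped≤smallest : ∀ c k (x : Vec ℕ n) → capped c x ≤ smallest k x + (n ∸ k) * c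
capped≤smallest {n} c k x = begin
  capped c x                                             ≡⟨ capped-sorted c x ⟨
  cappedList c (sorted x)                                ≤⟨ cappedList≤take c k (sorted x) ⟩
  smallest k x + (length (sorted x) ∸ k) * c             ≡⟨ cong (λ l → smallest k x + (l ∸ k) * c) (length-sorted x) ⟩
  smallest k x + (n ∸ k) * c                             ∎
  where open ≤-Reasoning

smallest-attained : ∀ k (x : Vec ℕ n) →
  ∃[ c ] smallest k x + (n ∸ k) * c ≤ capped c x
smallest-attained {n} k x
  with c , _ , bound ← take≤cappedList k 0 (sorted x) (All.tabulate λ _ → z≤n) (sorted-↗ x)
  = c , subst₂ (λ l s → smallest k x + (l ∸ k) * c ≤ s) (length-sorted x) (capped-sorted c x) bound

capped-attained : ∀ c (x : Vec ℕ n) →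
  ∃[ k ] k ≤ n × smallest k x + (n ∸ k) * c ≤ capped c x
capped-attained {n} c x
  with k , k≤ , bound ← cappedList-attained c (sorted x) (sorted-↗ x)
  = k , subst (k ≤_) (length-sorted x) k≤ ,
    subst₂ (λ l s → smallest k x + (l ∸ k) * c ≤ s) (length-sorted x) (capped-sorted c x) bound

-- `⪰` speaks only of positive `k`, while `capped-attained` may return 0.
⪰⇒smallest≤ : {x y : Vec ℕ n} → x ⪰ y → ∀ {k} → k ≤ n → smallest k x ≤ smallest k y
⪰⇒smallest≤ x⪰y {zero}  _    = z≤n
⪰⇒smallest≤ {x = x} {y} x⪰y {suc k} k<n =
  subst (λ k → smallest (suc k) x ≤ smallest (suc k) y) (toℕ-fromℕ< k<n) (proj₂ x⪰y (fromℕ< k<n))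

-- Take the `k` at which the dual minimum for `y` is attained; the same `k` still gives an upper
-- bound for `x`.
⪰⇒capped≤ : {x y : Vec ℕ n} → x ⪰ y → ∀ c → capped c x ≤ capped c y
⪰⇒capped≤ {n} {x} {y} x⪰y c with k , k≤n , bound ← capped-attained c y = begin
  capped c x                  ≤⟨ capped≤smallest c k x ⟩
  smallest k x + (n ∸ k) * c  ≤⟨ +-monoˡ-≤ _ (⪰⇒smallest≤ x⪰y k≤n) ⟩
  smallest k y + (n ∸ k) * c  ≤⟨ bound ⟩
  capped c y                  ∎
  where open ≤-Reasoning

-- Take the `c` at which the dual bound for `x` is attained, use the same `c` for `y`, and cancel
-- the common term.
capped≤⇒⪰ : {x y : Vec ℕ n} → Vec.sum x ≡ Vec.sum y →
  (∀ c → capped c x ≤ capped c y) → x ⪰ y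
capped≤⇒⪰ {n} {x} {y} sums≡ capped≤ = sums≡ , λ i → smallest≤ (suc (toℕ i))
  where
  open ≤-Reasoning
  smallest≤ : ∀ k → smallest k x ≤ smallest k y
  smallest≤ k with c , bound ← smallest-attained k x =
    +-cancelʳ-≤ ((n ∸ k) * c) _ _ (begin
    smallest k x + (n ∸ k) * c  ≤⟨ bound ⟩
    capped c x                  ≤⟨ capped≤ c ⟩
    capped c y                  ≤⟨ capped≤smallest c k y ⟩
    smallest k y + (n ∸ k) * c  ∎)

-- The conjugate of x, indexed as in the paper with x°(0) = n.
conj : Vec ℕ n → ℕ → ℕ
conj x k = Vec.count (k ≤?_) x

conj-∷-≤ : ∀ {k a} (x : Vec ℕ n) → k ≤ a → conj (a ∷ x) k ≡ suc (conj x k)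
conj-∷-≤ {k = k} {a} x k≤a =
  cong (λ b → (if b then suc else id) (conj x k)) (dec-true (k ≤? a) k≤a)

conj-∷-≰ : ∀ {k a} (x : Vec ℕ n) → k ≰ a → conj (a ∷ x) k ≡ conj x k
conj-∷-≰ {k = k} {a} x k≰a =
  cong (λ b → (if b then suc else id) (conj x k)) (dec-false (k ≤? a) k≰a)

-- Raising the cap by one adds one unit for each entry that exceeds the old cap.
capped-suc : ∀ c (x : Vec ℕ n) → capped (suc c) x ≡ capped c x + conj x (suc c)
capped-suc c [] = refl
capped-suc c (a ∷ x) with c <? a
... | yes c<a = begin
  a ⊓ suc c + capped (suc c) x               ≡⟨ cong₂ _+_ (m≥n⇒m⊓n≡n c<a) (capped-suc c x) ⟩
  suc c + (capped c x + conj x (suc c))      ≡⟨ lemma c (capped c x) _ ⟩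
  c + capped c x + suc (conj x (suc c))      ≡⟨ cong₂ (λ b d → b + capped c x + d) (m≥n⇒m⊓n≡n (<⇒≤ c<a)) (conj-∷-≤ x c<a) ⟨
  a ⊓ c + capped c x + conj (a ∷ x) (suc c)  ∎
  where
  open ≡-Reasoning
  lemma : ∀ c d e → suc c + (d + e) ≡ c + d + suc e
  lemma = solve-∀
... | no c≮a = begin
  a ⊓ suc c + capped (suc c) x               ≡⟨ cong₂ _+_ (m≤n⇒m⊓n≡m (m≤n⇒m≤1+n a≤c)) (capped-suc c x) ⟩
  a + (capped c x + conj x (suc c))          ≡⟨ +-assoc a _ _ ⟨
  a + capped c x + conj x (suc c)            ≡⟨ cong₂ (λ b d → b + capped c x + d) (m≤n⇒m⊓n≡m a≤c) (conj-∷-≰ x c≮a) ⟨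
  a ⊓ c + capped c x + conj (a ∷ x) (suc c)  ∎
  where
  open ≡-Reasoning
  a≤c = ≮⇒≥ c≮a

capped-0 : (x : Vec ℕ n) → capped 0 x ≡ 0
capped-0 []      = refl
capped-0 (a ∷ x) = cong₂ _+_ (⊓-zeroʳ a) (capped-0 x)

capped≡sum : ∀ c (x : Vec ℕ n) → Vec.sum x ≤ c → capped c x ≡ Vec.sum x
capped≡sum c []      _     = refl
capped≡sum c (a ∷ x) sum≤c =
  cong₂ _+_ (m≤n⇒m⊓n≡m (m+n≤o⇒m≤o a sum≤c)) (capped≡sum c x (m+n≤o⇒n≤o a sum≤c))

capped-𝟎 : ∀ n c → capped c (𝟎 {n}) ≡ 0
capped-𝟎 zero    c = refl
capped-𝟎 (suc n) c = capped-𝟎 n c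

conj-0 : (x : Vec ℕ n) → conj x 0 ≡ n
conj-0 []      = refl
conj-0 (a ∷ x) = cong suc (conj-0 x)

conj-antitone : ∀ k (x : Vec ℕ n) → conj x (suc k) ≤ conj x k
conj-antitone k [] = z≤n
conj-antitone k (a ∷ x) with k <? a | k ≤? a
... | yes k<a | _       rewrite conj-∷-≤ x k<a | conj-∷-≤ x (<⇒≤ k<a) = s≤s (conj-antitone k x)
... | no k≮a  | yes k≤a rewrite conj-∷-≰ x k≮a | conj-∷-≤ x k≤a = m≤n⇒m≤1+n (conj-antitone k x)
... | no k≮a  | no k≰a  rewrite conj-∷-≰ x k≮a | conj-∷-≰ x k≰a = conj-antitone k x

-- Vector addition and the effect of a single unit

𝟎-identityˡ : (x : Vec ℕ n) → 𝟎 ⊕ x ≡ x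
𝟎-identityˡ []      = refl
𝟎-identityˡ (a ∷ x) = cong (a ∷_) (𝟎-identityˡ x)

⊕-comm : (x y : Vec ℕ n) → x ⊕ y ≡ y ⊕ x
⊕-comm []      []      = refl
⊕-comm (a ∷ x) (b ∷ y) = cong₂ _∷_ (+-comm a b) (⊕-comm x y)

⊕-assoc : (x y z : Vec ℕ n) → x ⊕ y ⊕ z ≡ x ⊕ (y ⊕ z)
⊕-assoc []      []      []      = refl
⊕-assoc (a ∷ x) (b ∷ y) (c ∷ z) = cong₂ _∷_ (+-assoc a b c) (⊕-assoc x y z)

sum-⊕ : (x y : Vec ℕ n) → Vec.sum (x ⊕ y) ≡ Vec.sum x + Vec.sum y
sum-⊕ []      []      = refl
sum-⊕ (a ∷ x) (b ∷ y) rewrite sum-⊕ x y = +-interchange a b (Vec.sum x) (Vec.sum y)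

sum-𝟎 : ∀ n → Vec.sum (𝟎 {n}) ≡ 0
sum-𝟎 zero    = refl
sum-𝟎 (suc n) = sum-𝟎 n

capped-mono : ∀ c (x y : Vec ℕ n) → capped c x ≤ capped c (y ⊕ x)
capped-mono c []      []      = z≤n
capped-mono c (a ∷ x) (b ∷ y) = +-mono-≤ (⊓-monoˡ-≤ c (m≤n+m a b)) (capped-mono c x y)

capped-χ-below : ∀ c (x : Vec ℕ n) i → lookup x i < c → capped c (χ i ⊕ x) ≡ suc (capped c x)
capped-χ-below c (a ∷ x) Fin.zero a<c = cong₂ _+_
  (trans (m≤n⇒m⊓n≡m a<c) (cong suc (sym (m≤n⇒m⊓n≡m (<⇒≤ a<c)))))
  (cong (capped c) (𝟎-identityˡ x))
capped-χ-below c (a ∷ x) (Fin.suc i) xi<c =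
  trans (cong (a ⊓ c +_) (capped-χ-below c x i xi<c)) (+-suc (a ⊓ c) _)

capped-χ-above : ∀ c (x : Vec ℕ n) i → c ≤ lookup x i → capped c (χ i ⊕ x) ≡ capped c x
capped-χ-above c (a ∷ x) Fin.zero c≤a = cong₂ _+_
  (trans (m≥n⇒m⊓n≡n (m≤n⇒m≤1+n c≤a)) (sym (m≥n⇒m⊓n≡n c≤a)))
  (cong (capped c) (𝟎-identityˡ x))
capped-χ-above c (a ∷ x) (Fin.suc i) c≤xi = cong (a ⊓ c +_) (capped-χ-above c x i c≤xi)

lookup-χ-≡ : (i : Fin n) → lookup (χ i) i ≡ 1
lookup-χ-≡ i = lookup∘update i 𝟎 1

lookup-χ-≢ : {i j : Fin n} → j ≢ i → lookup (χ i) j ≡ 0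
lookup-χ-≢ {i = i} {j} j≢i = trans (lookup∘update′ j≢i 𝟎 1) (lookup-replicate j 0)

lookup-⊕ : ∀ (x y : Vec ℕ n) i → lookup (x ⊕ y) i ≡ lookup x i + lookup y i
lookup-⊕ x y i = lookup-zipWith _+_ i x y

*≤capped : ∀ c s (x : Vec ℕ n) → s ≤ n →
  (∀ i → toℕ i < s → c ≤ lookup x i) → c * s ≤ capped c x
*≤capped c zero    x       _        _  = ≤-trans (≤-reflexive (*-zeroʳ c)) z≤n
*≤capped c (suc s) (a ∷ x) (s≤s s≤n) c≤x = begin
  c * suc s           ≡⟨ *-suc c s ⟩
  c + c * s           ≤⟨ +-mono-≤ (≤-reflexive (sym (m≥n⇒m⊓n≡n (c≤x Fin.zero z<s))))
                           (*≤capped c s x s≤n λ i i<s → c≤x (Fin.suc i) (s<s i<s)) ⟩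
  a ⊓ c + capped c x  ∎
  where open ≤-Reasoning

-- Bases of polymatroids and the gain of Brick-Laying

⟨⟩-⊕ : ∀ (x y : Vec ℕ n) A → (x ⊕ y) ⟨ A ⟩ ≡ x ⟨ A ⟩ + y ⟨ A ⟩
⟨⟩-⊕ []      []      []          = refl
⟨⟩-⊕ (a ∷ x) (b ∷ y) (false ∷ A) = ⟨⟩-⊕ x y A
⟨⟩-⊕ (a ∷ x) (b ∷ y) (true ∷ A)  rewrite ⟨⟩-⊕ x y A =
  +-interchange a b (x ⟨ A ⟩) (y ⟨ A ⟩)

⟨⊤⟩ : (x : Vec ℕ n) → x ⟨ ⊤ ⟩ ≡ Vec.sum x
⟨⊤⟩ []      = refl
⟨⊤⟩ (a ∷ x) = cong (a +_) (⟨⊤⟩ x)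

⟨⊥⟩ : (x : Vec ℕ n) → x ⟨ ⊥ ⟩ ≡ 0
⟨⊥⟩ []      = refl
⟨⊥⟩ (a ∷ x) = ⟨⊥⟩ x

𝟎⟨⟩ : (A : Subset n) → 𝟎 ⟨ A ⟩ ≡ 0
𝟎⟨⟩ []          = refl
𝟎⟨⟩ (false ∷ A) = 𝟎⟨⟩ A
𝟎⟨⟩ (true ∷ A)  = 𝟎⟨⟩ A

χ⟨⟩-∈ : {i : Fin n} {A : Subset n} → i ∈ A → χ i ⟨ A ⟩ ≡ 1
χ⟨⟩-∈ {A = _ ∷ A}     here        = cong suc (𝟎⟨⟩ A)
χ⟨⟩-∈ {A = false ∷ A} (there i∈A) = χ⟨⟩-∈ i∈A
χ⟨⟩-∈ {A = true ∷ A}  (there i∈A) = χ⟨⟩-∈ i∈A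

χ⟨⟩-∉ : {i : Fin n} {A : Subset n} → i ∉ A → χ i ⟨ A ⟩ ≡ 0
χ⟨⟩-∉ {i = Fin.zero}  {false ∷ A} i∉A = 𝟎⟨⟩ A
χ⟨⟩-∉ {i = Fin.zero}  {true ∷ A}  i∉A = contradiction here i∉A
χ⟨⟩-∉ {i = Fin.suc i} {false ∷ A} i∉A = χ⟨⟩-∉ (i∉A ∘ there)
χ⟨⟩-∉ {i = Fin.suc i} {true ∷ A}  i∉A = χ⟨⟩-∉ (i∉A ∘ there)

-- Set against submodularity of the rank, this equality closes the tight sets under intersection and
-- union.
⟨⟩-modular : ∀ (x : Vec ℕ n) A B → x ⟨ A ∩ B ⟩ + x ⟨ A ∪ B ⟩ ≡ x ⟨ A ⟩ + x ⟨ B ⟩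
⟨⟩-modular []      []          []          = refl
⟨⟩-modular (a ∷ x) (false ∷ A) (false ∷ B) = ⟨⟩-modular x A B
⟨⟩-modular (a ∷ x) (false ∷ A) (true ∷ B)  = begin
  x ⟨ A ∩ B ⟩ + (a + x ⟨ A ∪ B ⟩)  ≡⟨ x+[y+z]≡y+[x+z] (x ⟨ A ∩ B ⟩) a _ ⟩
  a + (x ⟨ A ∩ B ⟩ + x ⟨ A ∪ B ⟩)  ≡⟨ cong (a +_) (⟨⟩-modular x A B) ⟩
  a + (x ⟨ A ⟩ + x ⟨ B ⟩)          ≡⟨ x+[y+z]≡y+[x+z] (x ⟨ A ⟩) a _ ⟨
  x ⟨ A ⟩ + (a + x ⟨ B ⟩)          ∎
  where
  open ≡-Reasoning
⟨⟩-modular (a ∷ x) (true ∷ A) (false ∷ B)  = begin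
  x ⟨ A ∩ B ⟩ + (a + x ⟨ A ∪ B ⟩)  ≡⟨ x+[y+z]≡y+[x+z] (x ⟨ A ∩ B ⟩) a _ ⟩
  a + (x ⟨ A ∩ B ⟩ + x ⟨ A ∪ B ⟩)  ≡⟨ cong (a +_) (⟨⟩-modular x A B) ⟩
  a + (x ⟨ A ⟩ + x ⟨ B ⟩)          ≡⟨ +-assoc a _ _ ⟨
  a + x ⟨ A ⟩ + x ⟨ B ⟩            ∎
  where
  open ≡-Reasoning
⟨⟩-modular (a ∷ x) (true ∷ A) (true ∷ B)   = begin
  a + x ⟨ A ∩ B ⟩ + (a + x ⟨ A ∪ B ⟩)    ≡⟨ +-interchange a (x ⟨ A ∩ B ⟩) a _ ⟩
  a + a + (x ⟨ A ∩ B ⟩ + x ⟨ A ∪ B ⟩)    ≡⟨ cong (a + a +_) (⟨⟩-modular x A B) ⟩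
  a + a + (x ⟨ A ⟩ + x ⟨ B ⟩)            ≡⟨ +-interchange a (x ⟨ A ⟩) a _ ⟨
  a + x ⟨ A ⟩ + (a + x ⟨ B ⟩)            ∎
  where
  open ≡-Reasoning

-- Splitting off a summand avoids truncated subtraction: an exchange then replaces `χ u` by `χ i`.
remove-unit : ∀ (x : Vec ℕ n) u → 0 < lookup x u → ∃[ x⁻ ] x ≡ χ u ⊕ x⁻
remove-unit (suc a ∷ x) Fin.zero    _ = a ∷ x , cong (suc a ∷_) (sym (𝟎-identityˡ x))
remove-unit (a ∷ x)     (Fin.suc u) p with x⁻ , eq ← remove-unit x u p = a ∷ x⁻ , cong (a ∷_) eq

-- Every unit that `x` places in `T` lands below the cap and counts in full; outside `T` the
-- truncated sum can only grow. Where `x` places nothing, `w` may exceed `q`.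
capped-⊕-⟨⟩ : ∀ q (w x : Vec ℕ n) T →
  (∀ {i} → i ∈ T → 0 < lookup x i → lookup (w ⊕ x) i ≤ q) →
  capped q w + x ⟨ T ⟩ ≤ capped q (w ⊕ x)
capped-⊕-⟨⟩ q []      []      []          _  = z≤n
capped-⊕-⟨⟩ q (a ∷ w) (b ∷ x) (false ∷ T) ≤q = begin
  a ⊓ q + capped q w + x ⟨ T ⟩          ≡⟨ +-assoc (a ⊓ q) _ _ ⟩
  a ⊓ q + (capped q w + x ⟨ T ⟩)        ≤⟨ +-mono-≤ (⊓-monoˡ-≤ q (m≤m+n a b)) (capped-⊕-⟨⟩ q w x T (≤q ∘ there)) ⟩
  (a + b) ⊓ q + capped q (w ⊕ x)        ∎
  where open ≤-Reasoning
capped-⊕-⟨⟩ q (a ∷ w) (b ∷ x) (true ∷ T)  ≤q = begin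
  a ⊓ q + capped q w + (b + x ⟨ T ⟩)    ≡⟨ +-interchange (a ⊓ q) _ b _ ⟩
  a ⊓ q + b + (capped q w + x ⟨ T ⟩)    ≤⟨ +-mono-≤ (entry b (≤q here)) (capped-⊕-⟨⟩ q w x T (≤q ∘ there)) ⟩
  (a + b) ⊓ q + capped q (w ⊕ x)        ∎
  where
  open ≤-Reasoning
  entry : ∀ b → (0 < b → a + b ≤ q) → a ⊓ q + b ≤ (a + b) ⊓ q
  entry zero    _ = ≤-reflexive (trans (+-identityʳ _) (cong (_⊓ q) (sym (+-identityʳ a))))
  entry (suc b) p = ≤-trans (+-monoˡ-≤ (suc b) (m⊓n≤m a q)) (≤-reflexive (sym (m≤n⇒m⊓n≡m (p z<s))))

-- Tight sets and the exchange argument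

module Exchange (P : Polymatroid n) (B : Basis P) where

  open Polymatroid P using (normalized; monotone; submodular)

  x : Vec ℕ n
  x = vector B

  x∈P : x ∈ₚ P
  x∈P = proj₁ (Basis.isBasis B)

  -- Together with `x∈P` this inequality is an equality.
  Tight : Subset n → Set
  Tight T = rank P T ≤ x ⟨ T ⟩

  tight-⊤ : Tight ⊤
  tight-⊤ = ≤-reflexive (sym (proj₂ (Basis.isBasis B)))

  tight-⊥ : Tight ⊥
  tight-⊥ = ≤-trans (≤-reflexive normalized) z≤n

  module _ {S T : Subset n} (tS : Tight S) (tT : Tight T) where

    -- The reverse inequality holds for each of the two terms separately by `x∈P`, so both terms are
    -- equalities.
    tight-sum : rank P (S ∩ T) + rank P (S ∪ T) ≤ x ⟨ S ∩ T ⟩ + x ⟨ S ∪ T ⟩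
    tight-sum = ≤-trans (submodular S T)
      (≤-trans (+-mono-≤ tS tT) (≤-reflexive (sym (⟨⟩-modular x S T))))

    tight-∩ : Tight (S ∩ T)
    tight-∩ = +-cancelʳ-≤ (rank P (S ∪ T)) _ _
      (≤-trans tight-sum (+-monoʳ-≤ (x ⟨ S ∩ T ⟩) (x∈P (S ∪ T))))

    tight-∪ : Tight (S ∪ T)
    tight-∪ = +-cancelˡ-≤ (rank P (S ∩ T)) _ _
      (≤-trans tight-sum (+-monoˡ-≤ (x ⟨ S ∪ T ⟩) (x∈P (S ∩ T))))

  -- If moving a unit from `u` to `i` leaves the polymatroid, some constraint `T` becomes violated.
  -- Its sum grew, so `T` contains `i` but not `u`; it grew by one only, so `T` was tight before.
  exchange : ∀ i u {x⁻} → x ≡ χ u ⊕ x⁻ →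
    IsBasis P (χ i ⊕ x⁻) ⊎ (∃[ T ] Tight T × i ∈ T × u ∉ T)
  exchange i u {x⁻} eq with anySubset? (λ T → ¬? ((χ i ⊕ x⁻) ⟨ T ⟩ ≤? rank P T))
  ... | no none = inj₁
    ( (λ A → ≮⇒≥ λ r< → none (A , <⇒≱ r<))
    , trans (move ∈⊤ ∈⊤) (proj₂ (Basis.isBasis B)) )
    where
    move : ∀ {T} → i ∈ T → u ∈ T → (χ i ⊕ x⁻) ⟨ T ⟩ ≡ x ⟨ T ⟩
    move {T} i∈T u∈T = begin
      (χ i ⊕ x⁻) ⟨ T ⟩       ≡⟨ ⟨⟩-⊕ (χ i) x⁻ T ⟩
      χ i ⟨ T ⟩ + x⁻ ⟨ T ⟩   ≡⟨ cong (_+ x⁻ ⟨ T ⟩) (trans (χ⟨⟩-∈ i∈T) (sym (χ⟨⟩-∈ u∈T))) ⟩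
      χ u ⟨ T ⟩ + x⁻ ⟨ T ⟩   ≡⟨ ⟨⟩-⊕ (χ u) x⁻ T ⟨
      (χ u ⊕ x⁻) ⟨ T ⟩       ≡⟨ cong (_⟨ T ⟩) eq ⟨
      x ⟨ T ⟩                ∎
      where open ≡-Reasoning
  ... | yes (T , violated) = inj₂ (T , tight , i∈T , u∉T)
    where
    open ≤-Reasoning
    yT : (χ i ⊕ x⁻) ⟨ T ⟩ ≡ χ i ⟨ T ⟩ + x⁻ ⟨ T ⟩
    yT = ⟨⟩-⊕ (χ i) x⁻ T
    xT : x ⟨ T ⟩ ≡ χ u ⟨ T ⟩ + x⁻ ⟨ T ⟩
    xT = trans (cong (_⟨ T ⟩) eq) (⟨⟩-⊕ (χ u) x⁻ T)
    χ< : χ u ⟨ T ⟩ < χ i ⟨ T ⟩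
    χ< = +-cancelʳ-< (x⁻ ⟨ T ⟩) _ _ (begin-strict
      χ u ⟨ T ⟩ + x⁻ ⟨ T ⟩  ≡⟨ xT ⟨
      x ⟨ T ⟩               ≤⟨ x∈P T ⟩
      rank P T              <⟨ ≰⇒> violated ⟩
      (χ i ⊕ x⁻) ⟨ T ⟩      ≡⟨ yT ⟩
      χ i ⟨ T ⟩ + x⁻ ⟨ T ⟩  ∎)
    i∈T : i ∈ T
    i∈T with i ∈? T
    ... | yes p = p
    ... | no ¬p = contradiction (subst (χ u ⟨ T ⟩ <_) (χ⟨⟩-∉ ¬p) χ<) λ ()
    u∉T : u ∉ T
    u∉T u∈T = <-irrefl refl (subst₂ _<_ (χ⟨⟩-∈ u∈T) (χ⟨⟩-∈ i∈T) χ<)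
    tight : Tight T
    tight = s≤s⁻¹ (begin
      suc (rank P T)              ≤⟨ ≰⇒> violated ⟩
      (χ i ⊕ x⁻) ⟨ T ⟩            ≡⟨ yT ⟩
      χ i ⟨ T ⟩ + x⁻ ⟨ T ⟩        ≡⟨ cong (_+ x⁻ ⟨ T ⟩) (χ⟨⟩-∈ i∈T) ⟩
      suc (x⁻ ⟨ T ⟩)              ≤⟨ s≤s (m≤n+m _ (χ u ⟨ T ⟩)) ⟩
      suc (χ u ⟨ T ⟩ + x⁻ ⟨ T ⟩)  ≡⟨ cong suc xT ⟨
      suc (x ⟨ T ⟩)               ∎)

  module _ {I : Fin n → Set} {U : Fin n → Set}
           (I? : ∀ i → Dec (I i)) (U? : ∀ u → Dec (U u))
           (separate : ∀ {i u} → I i → U u → ∃[ T ] Tight T × i ∈ T × u ∉ T) where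

    -- Intersects the tight sets that separate `i` from each `u` in turn, beginning with the full
    -- set, which is tight because `x` is a basis.
    separate-from-all : ∀ {i} → I i → (us : List (Fin n)) →
      ∃[ T ] Tight T × i ∈ T × All (λ u → U u → u ∉ T) us
    separate-from-all Ii []       = ⊤ , tight-⊤ , ∈⊤ , []
    separate-from-all Ii (u ∷ us) with separate-from-all Ii us | U? u
    ... | T , tT , i∈T , out | no ¬Uu = T , tT , i∈T , (λ Uu → contradiction Uu ¬Uu) ∷ out
    ... | T , tT , i∈T , out | yes Uu with S , tS , i∈S , u∉S ← separate Ii Uu =
      S ∩ T , tight-∩ tS tT , x∈p∩q⁺ (i∈S , i∈T) ,
      (λ _ → u∉S ∘ proj₁ ∘ x∈p∩q⁻ S T) ∷ All.map (λ p Uv → p Uv ∘ proj₂ ∘ x∈p∩q⁻ S T) out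

    -- Unites over `i` the tight sets around each `i` that avoid all of `U`.
    separate-all : (is : List (Fin n)) →
      ∃[ T ] Tight T × All (λ i → I i → i ∈ T) is × (∀ {u} → U u → u ∉ T)
    separate-all []       = ⊥ , tight-⊥ , [] , λ _ → ∉⊥
    separate-all (i ∷ is) with separate-all is | I? i
    ... | T , tT , in′ , out | no ¬Ii = T , tT , (λ Ii → contradiction Ii ¬Ii) ∷ in′ , out
    ... | T , tT , in′ , out | yes Ii with S , tS , i∈S , outS ← separate-from-all Ii (List.allFin n) =
      S ∪ T , tight-∪ tS tT ,
      (λ _ → x∈p∪q⁺ (inj₁ i∈S)) ∷ All.map (λ p Ij → x∈p∪q⁺ (inj₂ (p Ij))) in′ ,
      λ {u} Uu u∈ → [ All.lookup outS (∈-allFin u) Uu , out Uu ] (x∈p∪q⁻ S T u∈)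

  -- By maximality no unit lying above `q` can move to an agent of `A`, so tight sets separate `A`
  -- from the agents holding such units. Combined they give one tight `S` that contains `A` and in
  -- which every unit of `x` lands at level at most `q`; these units number `rank P S`, which is at
  -- least `rank P A`.
  capped-gain : ∀ q w A →
    (∀ y → capped q (w ⊕ vector {P = P} y) ≤ capped q (w ⊕ x)) →
    (∀ {i} → i ∈ A → lookup (w ⊕ x) i < q) →
    capped q w + rank P A ≤ capped q (w ⊕ x)
  capped-gain q w A maximal A<q = begin
    capped q w + rank P A   ≤⟨ +-monoʳ-≤ (capped q w) (monotone A⊆S) ⟩
    capped q w + rank P S   ≤⟨ +-monoʳ-≤ (capped q w) tS ⟩
    capped q w + x ⟨ S ⟩    ≤⟨ capped-⊕-⟨⟩ q w x S (λ i∈S 0<xi → ≮⇒≥ λ q< → S∌over i∈S (0<xi , q<)) ⟩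
    capped q (w ⊕ x)        ∎
    where
    open ≤-Reasoning
    Over : Fin n → Set
    Over u = 0 < lookup x u × q < lookup (w ⊕ x) u

    -- Moving a unit from u to i would raise capped q (w ⊕ x).
    separate : ∀ {i u} → i ∈ A → Over u → ∃[ T ] Tight T × i ∈ T × u ∉ T
    separate {i} {u} i∈A (0<xu , q<) with x⁻ , eq ← remove-unit x u 0<xu | exchange i u eq
    ... | inj₂ T = T
    ... | inj₁ y = contradiction (maximal record { isBasis = y }) (<⇒≱ (begin-strict
      capped q (w ⊕ x)              ≡⟨ cong (capped q) w⊕x ⟩
      capped q (χ u ⊕ (w ⊕ x⁻))     ≡⟨ capped-χ-above q (w ⊕ x⁻) u (s≤s⁻¹ (subst (q <_) at-u q<)) ⟩
      capped q (w ⊕ x⁻)             <⟨ n<1+n _ ⟩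
      suc (capped q (w ⊕ x⁻))       ≡⟨ capped-χ-below q (w ⊕ x⁻) i
                                         (≤-<-trans (≤-trans (m≤n+m _ (lookup (χ u) i)) (≤-reflexive (sym (at i)))) (A<q i∈A)) ⟨
      capped q (χ i ⊕ (w ⊕ x⁻))     ≡⟨ cong (capped q) (swap i) ⟨
      capped q (w ⊕ (χ i ⊕ x⁻))     ∎))
      where
      swap : ∀ j → w ⊕ (χ j ⊕ x⁻) ≡ χ j ⊕ (w ⊕ x⁻)
      swap j = trans (sym (⊕-assoc w (χ j) x⁻))
        (trans (cong (_⊕ x⁻) (⊕-comm w (χ j))) (⊕-assoc (χ j) w x⁻))
      w⊕x : w ⊕ x ≡ χ u ⊕ (w ⊕ x⁻)
      w⊕x = trans (cong (w ⊕_) eq) (swap u)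
      at : ∀ j → lookup (w ⊕ x) j ≡ lookup (χ u) j + lookup (w ⊕ x⁻) j
      at j = trans (cong (λ v → lookup v j) w⊕x) (lookup-⊕ (χ u) (w ⊕ x⁻) j)
      at-u : lookup (w ⊕ x) u ≡ suc (lookup (w ⊕ x⁻) u)
      at-u = trans (at u) (cong (_+ lookup (w ⊕ x⁻) u) (lookup-χ-≡ u))

    separation = separate-all (_∈? A) (λ u → (0 <? lookup x u) ×-dec (q <? lookup (w ⊕ x) u))
                              separate (List.allFin n)
    S = proj₁ separation
    tS : Tight S
    tS = proj₁ (proj₂ separation)
    A⊆S : A ⊆ S
    A⊆S {i} = All.lookup (proj₁ (proj₂ (proj₂ separation))) (∈-allFin i)
    S∌over : ∀ {u} → u ∈ S → ¬ Over u
    S∌over u∈S over = proj₂ (proj₂ (proj₂ separation)) over u∈S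

open Exchange using (capped-gain)

-- Hindsight loads against Brick-Laying

data PlayedBy (𝒜 : DeterministicAllocation n) : History n → Set where
  []  : PlayedBy 𝒜 []
  _∷_ : ∀ {H} P → PlayedBy 𝒜 H → PlayedBy 𝒜 ((P , 𝒜 H P) ∷ H)

play-playedBy : ∀ m 𝒫 (𝒜 : DeterministicAllocation n) k {H} →
  PlayedBy 𝒜 H → PlayedBy 𝒜 (play m 𝒫 𝒜 k H)
play-playedBy m 𝒫 𝒜 zero        p = p
play-playedBy m 𝒫 𝒜 (suc k) {H} p with does (totalRank H ≟ m)
... | true  = p
... | false = play-playedBy m 𝒫 𝒜 k (𝒫 H ∷ p)

-- Sums `capped-gain` over the rounds. Loads only grow, so agents below `q` at the end were below
-- `q` after every round.
ranks≤capped : {BL : DeterministicAllocation n} → IsBrickLaying BL →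
  ∀ {H} → PlayedBy BL H → ∀ q A → (∀ {i} → i ∈ A → lookup (load H) i < q) →
  sum (List.map (λ (P , _) → rank P A) H) ≤ capped q (load H)
ranks≤capped isBL [] q A A<q = z≤n
ranks≤capped {BL = BL} isBL {_ ∷ H} (P ∷ p) q A A<q = begin
  rank P A + sum (List.map (λ (P , _) → rank P A) H)  ≤⟨ +-monoʳ-≤ (rank P A) (ranks≤capped isBL p q A
                                                          (λ {i} i∈A → ≤-<-trans (m≤m+n _ _) (subst (_< q) (lookup-⊕ (load H) x i) (A<q′ i∈A)))) ⟩
  rank P A + capped q (load H)                        ≡⟨ +-comm (rank P A) _ ⟩
  capped q (load H) + rank P A                        ≤⟨ capped-gain P (BL H P) q (load H) A
                                                           (λ y → ⪰⇒capped≤ (IsBrickLaying.minimal isBL H P y) q)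
                                                           A<q′ ⟩
  capped q (load H ⊕ x)                               ≡⟨ cong (capped q) (⊕-comm (load H) x) ⟩
  capped q (x ⊕ load H)                               ∎
  where
  open ≤-Reasoning
  x = vector (BL H P)
  A<q′ : ∀ {i} → i ∈ A → lookup (load H ⊕ x) i < q
  A<q′ {i} i∈A = subst (λ v → lookup v i < q) (⊕-comm x (load H)) (A<q i∈A)

hindsight-⟨⟩≤ : ∀ {Ps} (zs : All (Basis {n}) Ps) A →
  ∑ (All.reduce vector zs) ⟨ A ⟩ ≤ sum (List.map (λ P → rank P A) Ps)
hindsight-⟨⟩≤ []       A = ≤-reflexive (𝟎⟨⟩ A)
hindsight-⟨⟩≤ (z ∷ zs) A = ≤-trans (≤-reflexive (⟨⟩-⊕ (vector z) _ A))
  (+-mono-≤ (proj₁ (Basis.isBasis z) A) (hindsight-⟨⟩≤ zs A))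

sum-basis : ∀ {P} (x : Basis {n} P) → Vec.sum (vector x) ≡ Rank P
sum-basis x = trans (sym (⟨⊤⟩ (vector x))) (proj₂ (Basis.isBasis x))

sum-hindsight : ∀ {Ps} (zs : All (Basis {n}) Ps) →
  Vec.sum (∑ (All.reduce vector zs)) ≡ sum (List.map Rank Ps)
sum-hindsight {n} []       = sum-𝟎 n
sum-hindsight     (z ∷ zs) = trans (sum-⊕ (vector z) _) (cong₂ _+_ (sum-basis z) (sum-hindsight zs))

sum-load : (H : History n) → Vec.sum (load H) ≡ totalRank H
sum-load {n} []            = sum-𝟎 n
sum-load     ((P , x) ∷ H) = trans (sum-⊕ (vector x) _) (cong₂ _+_ (sum-basis x) (sum-load H))

lower : ℕ → Vec ℕ n → Subset n
lower q = Vec.map (λ a → does (a <? q))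

lower-< : ∀ q (ℓ : Vec ℕ n) {i} → i ∈ lower q ℓ → lookup ℓ i < q
-- `does (a <? q)` computes to `a <ᵇ q`.
lower-< q ℓ {i} i∈A = <ᵇ⇒< (lookup ℓ i) q
  (subst T (trans (sym ([]=⇒lookup i∈A)) (lookup-map i _ ℓ)) _)

-- The agents outside `lower q ℓ` number `conj ℓ q` and count at most `c` each; the others count at
-- most their entry of `z`.
capped≤lower : ∀ c q (ℓ z : Vec ℕ n) → capped c z ≤ c * conj ℓ q + z ⟨ lower q ℓ ⟩
capped≤lower c q []      []      = z≤n
capped≤lower c q (a ∷ ℓ) (b ∷ z) with a <? q
... | yes a<q rewrite conj-∷-≰ ℓ (<⇒≱ a<q) | dec-true (a <? q) a<q = begin
  b ⊓ c + capped c z                            ≤⟨ +-mono-≤ (m⊓n≤m b c) (capped≤lower c q ℓ z) ⟩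
  b + (c * conj ℓ q + z ⟨ lower q ℓ ⟩)          ≡⟨ x+[y+z]≡y+[x+z] b (c * conj ℓ q) _ ⟩
  c * conj ℓ q + (b + z ⟨ lower q ℓ ⟩)          ∎
  where
  open ≤-Reasoning
... | no a≮q rewrite conj-∷-≤ ℓ (≮⇒≥ a≮q) | dec-false (a <? q) a≮q = begin
  b ⊓ c + capped c z                            ≤⟨ +-mono-≤ (m⊓n≤n b c) (capped≤lower c q ℓ z) ⟩
  c + (c * conj ℓ q + z ⟨ lower q ℓ ⟩)          ≡⟨ lemma c (conj ℓ q) _ ⟩
  c * suc (conj ℓ q) + z ⟨ lower q ℓ ⟩          ∎
  where
  open ≤-Reasoning
  lemma : ∀ c b d → c + (c * b + d) ≡ c * suc b + d
  lemma = solve-∀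

presented-∷ : ∀ P (x : Basis {n} P) H Ps → presented ((P , x) ∷ H) ++ Ps ≡ presented H ++ P ∷ Ps
presented-∷ P x H Ps = trans (cong (_++ Ps) (unfold-reverse P (List.map proj₁ H))) (++-assoc (presented H) _ _)

sum-presented : ∀ (f : Polymatroid n → ℕ) H →
  sum (List.map f (presented H)) ≡ sum (List.map (λ (P , _) → f P) H)
sum-presented f H = trans (sum-↭ (map⁺ f (↭-reverse (List.map proj₁ H)))) (cong sum (sym (map-∘ H)))

length-presented : (H : History n) → length (presented H) ≡ length H
length-presented H = trans (length-reverse (List.map proj₁ H)) (length-map proj₁ H)

-- Play against a fixed list without the stopping test; `play≡follow` relates it to actual play.
follow : DeterministicAllocation n → History n → List (Polymatroid n) → History n
follow 𝒜 H []       = H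
follow 𝒜 H (P ∷ Ps) = follow 𝒜 ((P , 𝒜 H P) ∷ H) Ps

follow-++ : ∀ 𝒜 (H : History n) Ps Qs → follow 𝒜 H (Ps ++ Qs) ≡ follow 𝒜 (follow 𝒜 H Ps) Qs
follow-++ 𝒜 H []       Qs = refl
follow-++ 𝒜 H (P ∷ Ps) Qs = follow-++ 𝒜 _ Ps Qs

presented-follow : ∀ 𝒜 (H : History n) Ps → presented (follow 𝒜 H Ps) ≡ presented H ++ Ps
presented-follow 𝒜 H []       = sym (++-identityʳ (presented H))
presented-follow 𝒜 H (P ∷ Ps) = trans (presented-follow 𝒜 _ Ps) (presented-∷ P (𝒜 H P) H Ps)

capped≤hindsight : {BL : DeterministicAllocation n} → IsBrickLaying BL →
  ∀ {H} → PlayedBy BL H → ∀ {z} → InHindsight H z → ∀ c q →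
  capped c z ≤ c * conj (load H) q + capped q (load H)
capped≤hindsight isBL {H} played {z} (zs , refl) c q = begin
  capped c z                                           ≤⟨ capped≤lower c q ℓ z ⟩
  c * conj ℓ q + z ⟨ A ⟩                               ≤⟨ +-monoʳ-≤ (c * conj ℓ q) (hindsight-⟨⟩≤ zs A) ⟩
  c * conj ℓ q + sum (List.map rankA (presented H))    ≡⟨ cong (c * conj ℓ q +_) (sum-presented rankA H) ⟩
  c * conj ℓ q + sum (List.map (rankA ∘ proj₁) H)      ≤⟨ +-monoʳ-≤ (c * conj ℓ q) (ranks≤capped isBL played q A (lower-< q ℓ)) ⟩
  c * conj ℓ q + capped q ℓ                            ∎
  where
  open ≤-Reasoning
  ℓ = load H
  A = lower q ℓ
  rankA : Polymatroid _ → ℕ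
  rankA P = rank P A

sum-InHindsight : (H : History n) → ∀ {z} → InHindsight H z → Vec.sum z ≡ totalRank H
sum-InHindsight H (zs , refl) = trans (sum-hindsight zs) (sum-presented Rank H)

drop-length-++ : ∀ {a} {A : Set a} (xs : List A) {ys} → drop (length xs) (xs ++ ys) ≡ ys
drop-length-++ []       = refl
drop-length-++ (x ∷ xs) = drop-length-++ xs

-- Nested sequences

∈-initial⁺ : ∀ {s} {i : Fin n} → toℕ i < s → i ∈ initial s
∈-initial⁺ {s = s} {i} i<s = lookup⇒[]= i _ (trans (lookup∘tabulate _ i) (dec-true (toℕ i <? s) i<s))

∈-initial⁻ : ∀ {s} {i : Fin n} → i ∈ initial s → toℕ i < s
∈-initial⁻ {s = s} {i} i∈ = <ᵇ⇒< (toℕ i) s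
  (subst T (trans (sym ([]=⇒lookup i∈)) (lookup∘tabulate _ i)) _)

initial-mono : ∀ {s t} → s ≤ t → initial {n} s ⊆ initial t
initial-mono s≤t i∈ = ∈-initial⁺ (≤-trans (∈-initial⁻ i∈) s≤t)

meets-nonempty : ∀ {N A : Subset n} → Nonempty (A ∩ N) → meets N A ≡ 1
meets-nonempty {N = N} {A} p with nonempty? (A ∩ N)
... | yes _ = refl
... | no ¬p = contradiction p ¬p

meets-positive : ∀ {N A : Subset n} → 0 < meets N A → Nonempty (A ∩ N)
meets-positive {N = N} {A} p with nonempty? (A ∩ N) | p
... | yes q | _ = q
... | no _  | ()

Rank-meets : ∀ {N : Subset n} → Nonempty N → Rank (meetsPolymatroid N) ≡ 1
Rank-meets (i , i∈N) = meets-nonempty (i , x∈p∩q⁺ (∈⊤ , i∈N))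

χ-basis⁺ : ∀ {i : Fin n} {N} → i ∈ N → IsBasis (meetsPolymatroid N) (χ i)
χ-basis⁺ {i = i} {N} i∈N = bounded , trans (χ⟨⟩-∈ {i = i} ∈⊤) (sym (Rank-meets (i , i∈N)))
  where
  bounded : ∀ A → χ i ⟨ A ⟩ ≤ meets N A
  bounded A with i ∈? A
  ... | yes i∈A = ≤-reflexive (trans (χ⟨⟩-∈ i∈A) (sym (meets-nonempty (i , x∈p∩q⁺ (i∈A , i∈N)))))
  ... | no  i∉A = ≤-trans (≤-reflexive (χ⟨⟩-∉ i∉A)) z≤n

-- The constraint for the singleton of `i` forces that singleton to meet `N`.
χ-basis⁻ : ∀ {i : Fin n} {N} → IsBasis (meetsPolymatroid N) (χ i) → i ∈ N
χ-basis⁻ {i = i} {N} (bounded , _)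
  with j , j∈ ← meets-positive {N = N} (≤-trans (≤-reflexive (sym (χ⟨⟩-∈ (x∈⁅x⁆ i)))) (bounded ⁅ i ⁆))
  with j∈i , j∈N ← x∈p∩q⁻ ⁅ i ⁆ N j∈
  = subst (_∈ N) (x∈⁅y⁆⇒x≡y i j∈i) j∈N

module NestedSequences (ℓ : Vec ℕ n) where

  ℓ° : ℕ → ℕ
  ℓ° = conj ℓ

  block : ℕ → Polymatroid n
  block p = meetsPolymatroid (initial (ℓ° p))

  -- The `k` blocks from index `p` on. Block `p` is the one with `j = p + 1` in the theorem, hence
  -- its `ℓ° (suc p)` copies on the first `ℓ° p` agents.
  blocks : ℕ → ℕ → List (Polymatroid n)
  blocks p zero    = []
  blocks p (suc k) = replicate (ℓ° (suc p)) (block p) ++ blocks (suc p) k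

  -- An arbitrary tabulated family with an offset, because peeling off the first block shifts the
  -- index of the rest.
  concat-blocks : ∀ p k (g : Fin k → List (Polymatroid n)) →
    (∀ j → g j ≡ replicate (ℓ° (suc (p + toℕ j))) (block (p + toℕ j))) →
    List.concat (List.tabulate g) ≡ blocks p k
  concat-blocks p zero    g g≡ = refl
  concat-blocks p (suc k) g g≡ = cong₂ _++_
    (trans (g≡ Fin.zero) (cong (λ j → replicate (ℓ° (suc j)) (block j)) (+-identityʳ p)))
    (concat-blocks (suc p) k (g ∘ Fin.suc) λ j →
      trans (g≡ (Fin.suc j)) (cong (λ j → replicate (ℓ° (suc j)) (block j)) (+-suc p (toℕ j))))

  lookup-conjugate : ∀ m (j : Fin m) → lookup (conjugate m ℓ) j ≡ ℓ° (suc (toℕ j))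
  lookup-conjugate m j = lookup∘tabulate _ j

  lookup-conjugate-inject₁ : ∀ m (j : Fin m) →
    lookup (n ∷ conjugate m ℓ) (inject₁ j) ≡ ℓ° (toℕ j)
  lookup-conjugate-inject₁ m       Fin.zero    = sym (conj-0 ℓ)
  lookup-conjugate-inject₁ (suc m) (Fin.suc j) = trans (lookup-conjugate (suc m) (inject₁ j))
    (cong (ℓ° ∘ suc) (toℕ-inject₁ j))

  nestedSequence≡blocks : ∀ m → nestedSequence m ℓ ≡ blocks 0 m
  nestedSequence≡blocks m = trans (cong List.concat (map-tabulate {n = m} id _))
    (concat-blocks 0 m _ λ j → cong₂ replicate (lookup-conjugate m j)
      (cong (meetsPolymatroid ∘ initial) (lookup-conjugate-inject₁ m j)))

  nonempty-initial : ∀ {p} → 0 < ℓ° p → Nonempty (initial {n} (ℓ° p))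
  nonempty-initial {p} 0<s = fromℕ< 0<n , ∈-initial⁺ (≤-trans (≤-reflexive (cong suc (toℕ-fromℕ< 0<n))) 0<s)
    where 0<n = ≤-trans 0<s (count≤n (p ≤?_) ℓ)

  -- Block `p` has a copy only if `ℓ° (suc p)` is positive; then so is `ℓ° p`, and the presented set
  -- is nonempty.
  blocks-rank-1 : ∀ p k → All (λ P → Rank P ≡ 1) (blocks p k)
  blocks-rank-1 p zero    = []
  blocks-rank-1 p (suc k) = ++⁺ (copies (ℓ° (suc p)) ≤-refl) (blocks-rank-1 (suc p) k)
    where
    copies : ∀ r → r ≤ ℓ° (suc p) → All (λ P → Rank P ≡ 1) (replicate r (block p))
    copies zero    _ = []
    copies (suc r) r< = replicate⁺ (suc r)
      (Rank-meets (nonempty-initial {p} (≤-trans (≤-trans z<s r<) (conj-antitone p ℓ))))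

  blockSets : ℕ → ℕ → List (Subset n)
  blockSets p zero    = []
  blockSets p (suc k) = replicate (ℓ° (suc p)) (initial (ℓ° p)) ++ blockSets (suc p) k

  Represents : Polymatroid n → Subset n → Set
  Represents P N = ∀ A → rank P A ≡ meets N A

  blocks-represented : ∀ p k → Pointwise Represents (blocks p k) (blockSets p k)
  blocks-represented p zero    = []
  blocks-represented p (suc k) =
    Pointwise.++⁺ (Pointwise.replicate⁺ (λ _ → refl) (ℓ° (suc p))) (blocks-represented (suc p) k)

  -- The set just before `Ns` is `M` if there are no copies and `N` otherwise, so the continuation
  -- must accept any superset of `N`.
  linked-replicate : ∀ {M N : Subset n} {Ns} r → M ⊇ N →
    (∀ {L} → L ⊇ N → Linked _⊇_ (L ∷ Ns)) → Linked _⊇_ (M ∷ replicate r N ++ Ns)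
  linked-replicate zero    M⊇N linked = linked M⊇N
  linked-replicate (suc r) M⊇N linked = M⊇N ∷ linked-replicate r id linked

  blockSets-linked : ∀ {M} p k → M ⊇ initial (ℓ° p) → Linked _⊇_ (M ∷ blockSets p k)
  blockSets-linked p zero    _   = [-]
  blockSets-linked p (suc k) M⊇N = linked-replicate (ℓ° (suc p)) M⊇N
    λ L⊇N → blockSets-linked (suc p) k (L⊇N ∘ initial-mono (conj-antitone p ℓ))

  -- `capped-suc` telescopes: `capped p ℓ` is the number of rounds before block `p`.
  length-blocks : ∀ p k → capped p ℓ + length (blocks p k) ≡ capped (p + k) ℓ
  length-blocks p zero    = trans (+-identityʳ _) (cong (λ q → capped q ℓ) (sym (+-identityʳ p)))
  length-blocks p (suc k) = begin
    capped p ℓ + length (blocks p (suc k))                              ≡⟨ cong (capped p ℓ +_) (length-++ (replicate (ℓ° (suc p)) (block p))) ⟩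
    capped p ℓ + (length (replicate (ℓ° (suc p)) (block p)) + len)      ≡⟨ cong (λ r → capped p ℓ + (r + len)) (length-replicate (ℓ° (suc p))) ⟩
    capped p ℓ + (ℓ° (suc p) + len)                                     ≡⟨ +-assoc (capped p ℓ) _ _ ⟨
    capped p ℓ + ℓ° (suc p) + len                                       ≡⟨ cong (_+ len) (capped-suc p ℓ) ⟨
    capped (suc p) ℓ + len                                              ≡⟨ length-blocks (suc p) k ⟩
    capped (suc p + k) ℓ                                                ≡⟨ cong (λ q → capped q ℓ) (+-suc p k) ⟨
    capped (p + suc k) ℓ                                                ∎
    where
    open ≡-Reasoning
    len = length (blocks (suc p) k)

  -- A good hindsight assignment for the nested sequence

  module Greedy (c : ℕ) where

    total : ∀ {Ps} → All (Basis {n}) Ps → Vec ℕ n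
    total zs = ∑ (All.reduce vector zs)

    -- Rounds are assigned from last to first. With `r` copies of block `p` treated and `e` still to
    -- come, `capped p ℓ + e` is the number of unassigned rounds; the invariant bounds the target by
    -- the truncated load so far plus that number.
    greedy-copies : ∀ p {Ps} →
      (∃[ zs ] ∃[ q ] c * ℓ° q + capped q ℓ ≤ capped c (total {Ps} zs) + capped (suc p) ℓ) →
      ∀ r e → e + r ≡ ℓ° (suc p) →
      ∃[ zs ] ∃[ q ] c * ℓ° q + capped q ℓ ≤
        capped c (total {replicate r (block p) ++ Ps} zs) + (capped p ℓ + e)
    greedy-copies p (zs , q , bound) zero e eq = zs , q ,
      ≤-trans bound (≤-reflexive (cong (capped c (total zs) +_)
        (trans (capped-suc p ℓ) (cong (capped p ℓ +_) (trans (sym eq) (+-identityʳ e))))))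
    greedy-copies p rest (suc r) e eq
      with zs , q , bound ← greedy-copies p rest r (suc e) (trans (sym (+-suc e r)) eq)
      with any? (λ i → (toℕ i <? ℓ° p) ×-dec (lookup (total zs) i <? c))
    -- An agent below `c` turns one unassigned round into one unit of truncated load, so `q` is
    -- kept.
    ... | yes (i , i<s , zi<c) = record { isBasis = χ-basis⁺ (∈-initial⁺ i<s) } ∷ zs , q , (begin
      c * ℓ° q + capped q ℓ                               ≤⟨ bound ⟩
      capped c (total zs) + (capped p ℓ + suc e)          ≡⟨ lemma (capped c (total zs)) (capped p ℓ) e ⟩
      suc (capped c (total zs)) + (capped p ℓ + e)        ≡⟨ cong (_+ (capped p ℓ + e)) (capped-χ-below c (total zs) i zi<c) ⟨
      capped c (χ i ⊕ total zs) + (capped p ℓ + e)        ∎)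
      where
      open ≤-Reasoning
      lemma : ∀ a b e → a + (b + suc e) ≡ suc a + (b + e)
      lemma = solve-∀
    -- All presented agents already carry `c`, so `q` is reset to `p`: they pay for `c * ℓ° p`, and
    -- the unassigned rounds for `capped p ℓ`. The recipient is then arbitrary.
    ... | no saturated = record { isBasis = χ-basis⁺ (proj₂ nonempty) } ∷ zs , p , (begin
      c * ℓ° p + capped p ℓ                               ≤⟨ +-mono-≤
                                                               (*≤capped c (ℓ° p) (total zs) (count≤n (p ≤?_) ℓ)
                                                                 (λ j j<s → ≮⇒≥ λ zj<c → saturated (j , j<s , zj<c)))
                                                               (m≤m+n (capped p ℓ) e) ⟩
      capped c (total zs) + (capped p ℓ + e)              ≤⟨ +-monoˡ-≤ _ (capped-mono c (total zs) (χ i)) ⟩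
      capped c (χ i ⊕ total zs) + (capped p ℓ + e)        ∎)
      where
      open ≤-Reasoning
      nonempty : Nonempty (initial {n} (ℓ° p))
      nonempty = nonempty-initial {p}
        (≤-trans (≤-trans (m≤n+m 1 (e + r)) (≤-reflexive (trans (+-comm (e + r) 1) (trans (sym (+-suc e r)) eq)))) (conj-antitone p ℓ))
      i = proj₁ nonempty

    greedy : ∀ {m} → Vec.sum ℓ ≡ m → ∀ p k → p + k ≡ m →
      ∃[ zs ] ∃[ q ] c * ℓ° q + capped q ℓ ≤ capped c (total {blocks p k} zs) + capped p ℓ
    -- Nothing is assigned yet. `suc m` exceeds every load, so its conjugate entry is 0 and the
    -- target is the total load, which equals the number of rounds.
    greedy {m} Σℓ≡m p zero p+0≡m = [] , suc m , (begin
      c * ℓ° (suc m) + capped (suc m) ℓ     ≡⟨ cong₂ (λ a b → c * a + b) ℓ°[1+m]≡0 (≡Σ (n≤1+n m)) ⟩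
      c * 0 + Vec.sum ℓ                     ≡⟨ cong (_+ Vec.sum ℓ) (*-zeroʳ c) ⟩
      Vec.sum ℓ                             ≡⟨ ≡Σ (≤-reflexive (trans (sym p+0≡m) (+-identityʳ p))) ⟨
      capped p ℓ                            ≤⟨ m≤n+m _ (capped c (𝟎 {n})) ⟩
      capped c (𝟎 {n}) + capped p ℓ         ∎)
      where
      open ≤-Reasoning
      ≡Σ : ∀ {c} → m ≤ c → capped c ℓ ≡ Vec.sum ℓ
      ≡Σ m≤c = capped≡sum _ ℓ (≤-trans (≤-reflexive Σℓ≡m) m≤c)
      ℓ°[1+m]≡0 : ℓ° (suc m) ≡ 0
      ℓ°[1+m]≡0 = +-cancelˡ-≡ (capped m ℓ) _ _ (trans (sym (capped-suc m ℓ))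
        (trans (≡Σ (n≤1+n m)) (trans (sym (≡Σ ≤-refl)) (sym (+-identityʳ _)))))
    greedy Σℓ≡m p (suc k) p+k≡m
      with zs , q , bound ← greedy-copies p
             (greedy Σℓ≡m (suc p) k (trans (sym (+-suc p k)) p+k≡m)) (ℓ° (suc p)) 0 refl
      = zs , q , ≤-trans bound (≤-reflexive (cong (capped c (total zs) +_) (+-identityʳ _)))

  -- The load v of Brick-Laying after k rounds of block p.
  record Stage (p k : ℕ) (v : Vec ℕ n) : Set where
    field
      filled   : ∀ {i} → toℕ i < k → lookup v i ≡ suc p
      unfilled : ∀ {i} → k ≤ toℕ i → toℕ i < ℓ° p → lookup v i ≡ p
      capped-≤ : ∀ {c} → c ≤ p → capped c v ≡ capped c ℓ
      capped-> : ∀ {c} → p < c → capped c v ≡ capped p ℓ + k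

  open Stage

  stage-start : Stage 0 0 𝟎
  stage-start = record
    { filled   = λ ()
    ; unfilled = λ {i} _ _ → lookup-replicate i 0
    ; capped-≤ = λ { z≤n → trans (capped-0 {n} 𝟎) (sym (capped-0 ℓ)) }
    ; capped-> = λ {c} _ → trans (capped-𝟎 n c) (sym (cong (_+ 0) (capped-0 ℓ)))
    }

  -- The agents filled during block `p` are exactly the set presented in block `p + 1`.
  stage-next : ∀ {p v} → Stage p (ℓ° (suc p)) v → Stage (suc p) 0 v
  stage-next {p} {v} s = record
    { filled   = λ ()
    ; unfilled = λ _ → s .filled
    ; capped-≤ = below
    ; capped-> = λ p<c → trans (s .capped-> (<⇒≤ p<c)) (sym (trans (+-identityʳ _) (capped-suc p ℓ)))
    }
    where
    below : ∀ {c} → c ≤ suc p → capped c v ≡ capped c ℓ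
    below {c} c≤1+p with m≤n⇒m<n∨m≡n c≤1+p
    ... | inj₁ c<1+p = s .capped-≤ (s≤s⁻¹ c<1+p)
    ... | inj₂ refl  = trans (s .capped-> ≤-refl) (sym (capped-suc p ℓ))

  module _ {BL : DeterministicAllocation n} (isBL : IsBrickLaying BL) where

    -- Brick-Laying picks the agent of index `k`: that agent is presented with load `p`, which
    -- excludes the agents before it, of load `suc p`, and the tie-break excludes those after it.
    stage-round : ∀ {p k} H → k < ℓ° (suc p) → Stage p k (load H) →
      Stage p (suc k) (vector (BL H (block p)) ⊕ load H)
    stage-round {p} {k} H k<r s
      with i , BL≡χ , minimal , lowest ← IsBrickLaying.tieBreak isBL H (block p)
             (Rank-meets (nonempty-initial {p} (≤-trans (≤-trans z<s k<r) (conj-antitone p ℓ))))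
      = subst (λ x → Stage p (suc k) (x ⊕ v)) (sym BL≡χ) record
      { filled   = λ {j} j<1+k → filled′ (m≤n⇒m<n∨m≡n (s≤s⁻¹ j<1+k))
      ; unfilled = λ {j} k<j j<s → trans (other (λ { refl → <⇒≢ k<j (sym i≡k) })) (s .unfilled (<⇒≤ k<j) j<s)
      ; capped-≤ = λ {c} c≤p → trans (capped-χ-above c v i (subst (c ≤_) (sym vi≡p) c≤p)) (s .capped-≤ c≤p)
      ; capped-> = λ {c} p<c → trans (capped-χ-below c v i (subst (_< c) (sym vi≡p) p<c))
                     (trans (cong suc (s .capped-> p<c)) (sym (+-suc _ k)))
      }
      where
      v = load H
      k<s : k < ℓ° p
      k<s = ≤-trans k<r (conj-antitone p ℓ)
      k<n : k < n
      k<n = ≤-trans k<s (count≤n (p ≤?_) ℓ)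
      k′ : Fin n
      k′ = fromℕ< k<n
      k′≡k : toℕ k′ ≡ k
      k′≡k = toℕ-fromℕ< k<n
      k′-basis : IsBasis (block p) (χ k′)
      k′-basis = χ-basis⁺ (∈-initial⁺ (subst (_< ℓ° p) (sym k′≡k) k<s))
      vk≡p : lookup v k′ ≡ p
      vk≡p = s .unfilled (≤-reflexive (sym k′≡k)) (subst (_< ℓ° p) (sym k′≡k) k<s)
      i<s : toℕ i < ℓ° p
      i<s = ∈-initial⁻ (χ-basis⁻ (subst (IsBasis (block p)) BL≡χ (Basis.isBasis (BL H (block p)))))
      vi≤p : lookup v i ≤ p
      vi≤p = ≤-trans (minimal k′ k′-basis) (≤-reflexive vk≡p)
      k≤i : k ≤ toℕ i
      k≤i = ≮⇒≥ λ i<k → <⇒≱ (≤-reflexive (sym (s .filled i<k))) vi≤p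
      vi≡p : lookup v i ≡ p
      vi≡p = s .unfilled k≤i i<s
      i≡k : toℕ i ≡ k
      i≡k = ≤-antisym (≤-trans (lowest k′ k′-basis (trans vk≡p (sym vi≡p))) (≤-reflexive k′≡k)) k≤i
      other : ∀ {j} → j ≢ i → lookup (χ i ⊕ v) j ≡ lookup v j
      other {j} j≢i = trans (lookup-⊕ (χ i) v j) (cong (_+ lookup v j) (lookup-χ-≢ j≢i))
      filled′ : ∀ {j} → toℕ j < k ⊎ toℕ j ≡ k → lookup (χ i ⊕ v) j ≡ suc p
      filled′ (inj₁ j<k) = trans (other λ { refl → <⇒≢ j<k i≡k }) (s .filled j<k)
      filled′ {j} (inj₂ j≡k) with refl ← toℕ-injective {i = j} {i} (trans j≡k (sym i≡k)) =
        trans (lookup-⊕ (χ i) v i) (cong₂ _+_ (lookup-χ-≡ i) vi≡p)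

    stage-copies : ∀ {p k} r H → k + r ≡ ℓ° (suc p) → Stage p k (load H) →
      Stage p (ℓ° (suc p)) (load (follow BL H (replicate r (block p))))
    stage-copies {p} {k} zero    H eq s = subst (λ k → Stage p k (load H)) (trans (sym (+-identityʳ k)) eq) s
    stage-copies {p} {k} (suc r) H eq s = stage-copies r _ (trans (sym (+-suc k r)) eq)
      (stage-round H (m+n≤o⇒m≤o (suc k) (≤-reflexive (trans (sym (+-suc k r)) eq))) s)

    stage-blocks : ∀ p k H → Stage p 0 (load H) → Stage (p + k) 0 (load (follow BL H (blocks p k)))
    stage-blocks p zero    H s = subst (λ p → Stage p 0 (load H)) (sym (+-identityʳ p)) s
    stage-blocks p (suc k) H s
      rewrite follow-++ BL H (replicate (ℓ° (suc p)) (block p)) (blocks (suc p) k) | +-suc p k =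
      stage-blocks (suc p) k _ (stage-next (stage-copies (ℓ° (suc p)) H refl s))

    -- The stage reached after `m` blocks settles every cap up to `m`; beyond that, both sides are
    -- the total load.
    capped-follow : ∀ {m} → Vec.sum ℓ ≡ m → ∀ c →
      capped c (load (follow BL [] (blocks 0 m))) ≡ capped c ℓ
    capped-follow {m} Σℓ≡m c with c ≤? m
    ... | yes c≤m = stage-blocks 0 m [] stage-start .capped-≤ c≤m
    ... | no  c≰m = begin
      capped c (load (follow BL [] (blocks 0 m)))  ≡⟨ stage-blocks 0 m [] stage-start .capped-> (≰⇒> c≰m) ⟩
      capped m ℓ + 0                               ≡⟨ +-identityʳ _ ⟩
      capped m ℓ                                   ≡⟨ capped≡sum m ℓ (≤-reflexive Σℓ≡m) ⟩
      Vec.sum ℓ                                    ≡⟨ capped≡sum c ℓ (≤-trans (≤-reflexive Σℓ≡m) (≰⇒≥ c≰m)) ⟨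
      capped c ℓ                                   ∎
      where open ≡-Reasoning

-- Probabilities

module Probability {c ℓ₁ ℓ₂ ℓ₃} (𝕂 : OrderedField c ℓ₁ ℓ₂ ℓ₃) where

  open OrderedField 𝕂 using (heytingField)
  open HeytingField heytingField
    using (Carrier; _≈_; 0#; 1#; -‿inverseʳ; #-irrefl; invertible⇒#)
    renaming (_+_ to _+ᶠ_; _*_ to _*ᶠ_; -_ to -ᶠ_;
              refl to ≈-refl; sym to ≈-sym; trans to ≈-trans;
              +-cong to +ᶠ-cong; +-identityˡ to +ᶠ-identityˡ; +-identityʳ to +ᶠ-identityʳ;
              *-cong to *ᶠ-cong; *-identityˡ to *ᶠ-identityˡ; *-identityʳ to *ᶠ-identityʳ)

  -- The difference of 1 and 0 is invertible, so they are apart, and apartness is irreflexive.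
  1≉0 : ¬ 1# ≈ 0#
  1≉0 1≈0 = #-irrefl 1≈0 (invertible⇒#
    (1# , ≈-trans (*ᶠ-identityˡ _) 1-0≈1 , ≈-trans (*ᶠ-identityʳ _) 1-0≈1))
    where
    1-0≈1 : 1# +ᶠ (-ᶠ 0#) ≈ 1#
    1-0≈1 = ≈-trans
      (+ᶠ-cong ≈-refl (≈-trans (≈-sym (+ᶠ-identityˡ (-ᶠ 0#))) (-‿inverseʳ 0#))) (+ᶠ-identityʳ 1#)

  expectation-1 : {A : Set} (μ : Distribution 𝕂 A) {f : A → Carrier} →
    (∀ a → f a ≈ 1#) → expectation 𝕂 μ f ≈ 1#
  expectation-1 μ {f} f≈1 = ≈-trans (weights (Distribution.outcomes μ)) (Distribution.total μ)
    where
    weights : ∀ ws → sumᶠ 𝕂 (List.map (λ (w , a) → w *ᶠ f a) ws) ≈ sumᶠ 𝕂 (List.map proj₁ ws)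
    weights []             = ≈-refl
    weights ((w , a) ∷ ws) = +ᶠ-cong (≈-trans (*ᶠ-cong ≈-refl (f≈1 a)) (*ᶠ-identityʳ w)) (weights ws)

  probability-deterministic : ∀ m 𝒫 (𝒜 : DeterministicAllocation n) k S H →
    probability 𝕂 m 𝒫 (deterministic 𝕂 𝒜) k S H ≈ (if S (play m 𝒫 𝒜 k H) then 1# else 0#)
  probability-deterministic m 𝒫 𝒜 zero    S H = ≈-refl
  probability-deterministic m 𝒫 𝒜 (suc k) S H with does (totalRank H ≟ m)
  ... | true  = ≈-refl
  ... | false = ≈-trans (+ᶠ-identityʳ _) (≈-trans (*ᶠ-identityˡ _)
                  (probability-deterministic m 𝒫 𝒜 k S _))

  -- Under a deterministic profile the probability of `S` is its indicator at the resulting history;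
  -- the value 0 would contradict `1≉0`.
  AlmostSurely-play : ∀ m 𝒫 (𝒜 : DeterministicAllocation n) k {E : History n → Set} →
    AlmostSurely 𝕂 m 𝒫 (deterministic 𝕂 𝒜) k E → E (play m 𝒫 𝒜 k [])
  AlmostSurely-play m 𝒫 𝒜 k (S , S⇒E , p≈1) = S⇒E _
    (holds (≈-trans (≈-sym (probability-deterministic m 𝒫 𝒜 k S [])) p≈1))
    where
    holds : ∀ {b} → (if b then 1# else 0#) ≈ 1# → T b
    holds {true}  _   = _
    holds {false} 0≈1 = 1≉0 (≈-sym 0≈1)

  -- Playing a fixed sequence of rank-one polymatroids

  module FixedSequence (d : Polymatroid n) (seq : List (Polymatroid n))
                       (rank-1 : All (λ P → Rank P ≡ 1) seq) {m} (length≡m : length seq ≡ m) where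

    strategy : AdversarialStrategy n
    strategy H = fromMaybe d (head (drop (length H) seq))

    sum-Rank : ∀ {Ps} → All (λ P → Rank {n} P ≡ 1) Ps → sum (List.map Rank Ps) ≡ length Ps
    sum-Rank []       = refl
    sum-Rank (r ∷ rs) = cong₂ _+_ r (sum-Rank rs)

    module _ {H : History n} {Ps} (eq : presented H ++ Ps ≡ seq) where

      -- Every presented polymatroid has rank 1, so the total rank counts the rounds.
      totalRank+length : totalRank H + length Ps ≡ m
      totalRank+length = begin
        totalRank H + length Ps                     ≡⟨ cong (_+ length Ps) (sum-presented Rank H) ⟨
        sum (List.map Rank (presented H)) + length Ps ≡⟨ cong (_+ length Ps) (sum-Rank (++⁻ˡ (presented H) (subst (All _) (sym eq) rank-1))) ⟩
        length (presented H) + length Ps            ≡⟨ length-++ (presented H) ⟨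
        length (presented H ++ Ps)                  ≡⟨ cong length eq ⟩
        length seq                                  ≡⟨ length≡m ⟩
        m                                           ∎
        where
        open ≡-Reasoning

      strategy-head : strategy H ≡ fromMaybe d (head Ps)
      strategy-head = cong (fromMaybe d ∘ head) (begin
        drop (length H) seq                               ≡⟨ cong₂ drop (length-presented H) eq ⟨
        drop (length (presented H)) (presented H ++ Ps)   ≡⟨ drop-length-++ (presented H) ⟩
        Ps                                                ∎)
        where open ≡-Reasoning

    unfinished : ∀ {H P Ps} → presented H ++ P ∷ Ps ≡ seq → does (totalRank H ≟ m) ≡ false
    unfinished {H} {P} {Ps} eq = dec-false (totalRank H ≟ m)
      (<⇒≢ (≤-trans (m<m+n (totalRank H) z<s) (≤-reflexive (totalRank+length {H} {P ∷ Ps} eq))))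

    play≡follow : ∀ 𝒜 Ps H → presented H ++ Ps ≡ seq →
      play m strategy 𝒜 (length Ps) H ≡ follow 𝒜 H Ps
    play≡follow 𝒜 []       H eq = refl
    play≡follow 𝒜 (P ∷ Ps) H eq rewrite unfinished {H} eq | strategy-head {H} eq =
      play≡follow 𝒜 Ps _ (trans (presented-∷ P (𝒜 H P) H Ps) eq)

    probability-1 : ∀ 𝒜 S → (∀ H → presented H ≡ seq → T (S H)) →
      ∀ Ps H → presented H ++ Ps ≡ seq → probability 𝕂 m strategy 𝒜 (length Ps) S H ≈ 1#
    probability-1 𝒜 S holds [] H eq
      rewrite Equivalence.to T-≡ (holds H (trans (sym (++-identityʳ _)) eq)) = ≈-refl
    probability-1 𝒜 S holds (P ∷ Ps) H eq rewrite unfinished {H} eq | strategy-head {H} eq =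
      expectation-1 (𝒜 H P) λ x →
        probability-1 𝒜 S holds Ps _ (trans (presented-∷ P x H Ps) eq)

    -- The decision procedure for `E` serves as the Boolean event, which holds on every history
    -- presenting all of `seq`.
    almost-surely : ∀ 𝒜 {E : History n → Set} → (∀ H → Dec (E H)) →
      (∀ H → presented H ≡ seq → E H) → AlmostSurely 𝕂 m strategy 𝒜 m E
    almost-surely 𝒜 E? holds = (λ H → isYes (E? H)) , (λ H → toWitness) ,
      subst (λ k → probability 𝕂 m strategy 𝒜 k (λ H → isYes (E? H)) [] ≈ 1#) length≡m
        (probability-1 𝒜 (λ H → isYes (E? H)) (λ H → fromWitness ∘ holds H) seq [] refl)

open Probability using (AlmostSurely-play; module FixedSequence)

-- There are finitely many subsets, so a counterexample can be searched for.
represents? : (P : Polymatroid n) (N : Subset n) → Dec (∀ A → rank P A ≡ meets N A)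
represents? P N = map′
  (λ none A → decidable-stable (rank P A ≟ meets N A) λ ≢ → none (A , ≢))
  (λ all (A , ≢) → ≢ (all A))
  (¬? (anySubset? λ A → ¬? (rank P A ≟ meets N A)))

-- Comparing the given strategy with the nested one

module Lemma1 {c ℓ₁ ℓ₂ ℓ₃} (𝕂 : OrderedField c ℓ₁ ℓ₂ ℓ₃) (n m : ℕ)
  (BL : DeterministicAllocation n) (isBL : IsBrickLaying BL)
  (𝒫 : AdversarialStrategy n) (𝒫∈ : IsAdversarial 𝕂 m 𝒫) where

  H : History n
  H = outcome 𝕂 𝒫∈ BL

  rounds : ℕ
  rounds = proj₁ (𝒫∈ (deterministic 𝕂 BL))

  ℓ : Vec ℕ n
  ℓ = load H

  totalRank≡m : totalRank H ≡ m
  totalRank≡m = AlmostSurely-play 𝕂 m 𝒫 BL rounds (proj₂ (𝒫∈ (deterministic 𝕂 BL)))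

  sum-ℓ : Vec.sum ℓ ≡ m
  sum-ℓ = trans (sum-load H) totalRank≡m

  open NestedSequences ℓ

  seq : List (Polymatroid n)
  seq = nestedSequence m ℓ

  seq≡blocks : seq ≡ blocks 0 m
  seq≡blocks = nestedSequence≡blocks m

  length-seq : length seq ≡ m
  length-seq = begin
    length seq                         ≡⟨ cong length seq≡blocks ⟩
    length (blocks 0 m)                ≡⟨ cong (_+ length (blocks 0 m)) (capped-0 ℓ) ⟨
    capped 0 ℓ + length (blocks 0 m)   ≡⟨ length-blocks 0 m ⟩
    capped m ℓ                         ≡⟨ capped≡sum m ℓ (≤-reflexive sum-ℓ) ⟩
    Vec.sum ℓ                          ≡⟨ sum-ℓ ⟩
    m                                  ∎
    where open ≡-Reasoning

  -- With this default, `strategy` agrees definitionally with `nestedStrategy m ℓ`.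
  open FixedSequence 𝕂 (meetsPolymatroid ⊥) seq
    (subst (All _) (sym seq≡blocks) (blocks-rank-1 0 m)) length-seq

  complete : ∀ H → presented H ≡ seq → totalRank H ≡ m
  complete H eq = trans (sym (+-identityʳ _)) (totalRank+length {H} {[]} (trans (++-identityʳ _) eq))

  strategy-adversarial : IsAdversarial 𝕂 m (nestedStrategy m ℓ)
  strategy-adversarial 𝒜 = m , almost-surely 𝒜 (λ H → totalRank H ≟ m) complete

  Ns : List (Subset n)
  Ns = blockSets 0 m

  strategy-nested : IsNested 𝕂 m (nestedStrategy m ℓ)
  strategy-nested 𝒜 =
    -- Fixing the sets to be `Ns` makes the event decidable; the chain condition on `Ns` is supplied
    -- afterwards.
    let S , S⇒E , p≈1 = almost-surely 𝒜
          (λ H → (totalRank H ≟ m) ×-dec (length H ≟ m) ×-dec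
                 Pointwise.decidable represents? (presented H) Ns)
          (λ H eq → complete H eq ,
                    trans (sym (length-presented H)) (trans (cong length eq) length-seq) ,
                    subst (λ Ps → Pointwise Represents Ps Ns) (sym (trans eq seq≡blocks)) (blocks-represented 0 m))
    in m , S , (λ H s → let r , l , represented = S⇒E H s in
                        r , l , Ns , represented , Linked.tail (blockSets-linked 0 m ⊆⊤)) , p≈1

  Ĥ : History n
  Ĥ = outcome 𝕂 strategy-adversarial BL

  Ĥ≡follow : Ĥ ≡ follow BL [] seq
  -- The round bound returned by `strategy-adversarial` is `m`, the length of `seq`.
  Ĥ≡follow = trans (cong (λ k → play m strategy BL k []) (sym length-seq)) (play≡follow BL seq [] refl)

  presented-Ĥ : presented Ĥ ≡ blocks 0 m
  presented-Ĥ = trans (cong presented Ĥ≡follow) (trans (presented-follow BL [] seq) seq≡blocks)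

  totalRank-Ĥ : totalRank Ĥ ≡ m
  totalRank-Ĥ = complete Ĥ (trans presented-Ĥ (sym seq≡blocks))

  capped-load-Ĥ : ∀ c → capped c (load Ĥ) ≡ capped c ℓ
  capped-load-Ĥ c = trans (cong (capped c ∘ load) (trans Ĥ≡follow (cong (follow BL []) seq≡blocks)))
                          (capped-follow isBL sum-ℓ c)

  loads-equivalent : ℓ ∼ load Ĥ
  loads-equivalent =
    capped≤⇒⪰ (sym sums≡) (≤-reflexive ∘ capped-load-Ĥ) ,
    capped≤⇒⪰ sums≡ (≤-reflexive ∘ sym ∘ capped-load-Ĥ)
    where
    sums≡ : Vec.sum ℓ ≡ Vec.sum (load Ĥ)
    sums≡ = trans sum-ℓ (sym (trans (sum-load Ĥ) totalRank-Ĥ))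

  -- The greedy load `z` depends on the cap `c`, but `opt̂` is majorized by all of them and so has
  -- the largest truncated sum at every cap.
  optima-ordered : ∀ opt opt̂ → IsOPT H opt → IsOPT Ĥ opt̂ → opt ⪰ opt̂
  optima-ordered opt opt̂ (opt∈ , _) (opt̂∈ , opt̂-minimal) = capped≤⇒⪰
    (trans (trans (sum-InHindsight H opt∈) totalRank≡m)
           (sym (trans (sum-InHindsight Ĥ opt̂∈) totalRank-Ĥ)))
    λ c → bound c (Greedy.greedy c sum-ℓ 0 m refl)
    where
    open ≤-Reasoning
    bound : ∀ c →
      (∃[ zs ] ∃[ q ] c * ℓ° q + capped q ℓ ≤ capped c (∑ (All.reduce {P = Basis} {xs = blocks 0 m} vector zs)) + capped 0 ℓ) →
      capped c opt ≤ capped c opt̂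
    bound c (zs , q , greedy) = begin
      capped c opt                       ≤⟨ capped≤hindsight isBL (play-playedBy m 𝒫 BL rounds []) opt∈ c q ⟩
      c * ℓ° q + capped q ℓ              ≤⟨ greedy ⟩
      capped c z + capped 0 ℓ            ≡⟨ cong (capped c z +_) (capped-0 ℓ) ⟩
      capped c z + 0                     ≡⟨ +-identityʳ _ ⟩
      capped c z                         ≤⟨ ⪰⇒capped≤ (opt̂-minimal z z∈) c ⟩
      capped c opt̂                       ∎
      where
      z = ∑ (All.reduce vector zs)
      z∈ : InHindsight Ĥ z
      z∈ = subst (λ Ps → Σ[ zs ∈ All Basis Ps ] z ≡ ∑ (All.reduce vector zs)) (sym presented-Ĥ) (zs , refl)

lemma1 : ∀ {c ℓ₁ ℓ₂ ℓ₃} (𝕂 : OrderedField c ℓ₁ ℓ₂ ℓ₃) (n m : ℕ)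
    (BL : DeterministicAllocation n) → IsBrickLaying BL →
    (𝒫 : AdversarialStrategy n) (𝒫∈ : IsAdversarial 𝕂 m 𝒫) →
    let 𝒫̂ = nestedStrategy m (finalLoad 𝕂 𝒫∈ BL) in
    Σ[ 𝒫̂∈ ∈ IsAdversarial 𝕂 m 𝒫̂ ]
    ( IsNested 𝕂 m 𝒫̂
    × finalLoad 𝕂 𝒫∈ BL ∼ finalLoad 𝕂 𝒫̂∈ BL
    × (∀ opt opt̂ → IsOPT (outcome 𝕂 𝒫∈ BL) opt →
    IsOPT (outcome 𝕂 𝒫̂∈ BL) opt̂ → opt ⪰ opt̂) )
lemma1 𝕂 n m BL isBL 𝒫 𝒫∈ =
  strategy-adversarial , strategy-nested , loads-equivalent , optima-ordered
  where open Lemma1 𝕂 n m BL isBL 𝒫 𝒫∈
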